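{- Let $\mathcal E$ and $\mathcal E'$ be systems of equations in the Internal $\pi$-calculus such that $\mathcal E'$ extends $\mathcal E$ with respect to $\sqsubseteq_{\mathrm{tr}}$, and suppose $\mathcal E'$ is guarded and its syntactic solution has no divergences. If $\tilde F$ is a post-fixed point for $\sqsubseteq_{\mathrm{tr}}$ of $\mathcal E$ and $\tilde G$ is a pre-fixed point for $\sqsubseteq_{\mathrm{tr}}$ of $\mathcal E$, then $\tilde F\sqsubseteq_{\mathrm{tr}}\tilde G$.
   Context: Internal $\pi$-calculus: polyadic, well-sorted $\pi$-calculus with processes $P ::= 0\mid a(\tilde b).P\mid \overline a(\tilde b).P\mid(\nu a)P\mid P|P\mid\ !a(\tilde b).P\mid F\langle\tilde a\rangle$, abstractions $F::=(\tilde a)P\mid K$ (constants $K\triangleq(\tilde x)P$ with $P$ name-closed); all outputs bound, tuple components pairwise distinct; standard ground labelled transition system. For a sequence $s$ of visible actions $\mu_1,\dots,\mu_n$, $P\overset{s}{\Longrightarrow}$ if $P\overset{\mu_1}{\Longrightarrow}\cdots\overset{\mu_n}{\Longrightarrow}P_n$. $P\sqsubseteq_{\mathrm{tr}}Q$ if $P\overset{s}{\Longrightarrow}$ implies $Q\overset{s}{\Longrightarrow}$ for all $s$; extended to abstractions via fresh names, and to tuples componentwise. A process diverges if it has an infinite sequence of transitions that from some point on are all $\tau$; an abstraction diverges if its application to fresh names does. Expressions are name-closed abstractions possibly containing applications $X\langle\tilde a\rangle$ of equation variables. A system $\{X_i=E_i\}_{i\in I}$ ($I$ countable) is guarded if every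 occurrence of a variable in each $E_i$ is underneath a prefix. $E[\tilde F]$ replaces each $X_i$ by $F_i$. Syntactic solution: constants $K_{\mathcal E,i}\triangleq E_i[\tilde K_{\mathcal E}]$. $\tilde F$ is a pre-fixed point for $\sqsubseteq_{\mathrm{tr}}$ if $E_i[\tilde F]\sqsubseteq_{\mathrm{tr}}F_i$ for all $i$, a post-fixed point if $F_i\sqsubseteq_{\mathrm{tr}}E_i[\tilde F]$ for all $i$. $\mathcal E'$ extends $\mathcal E$ with respect to $\sqsubseteq_{\mathrm{tr}}$ if there is a fixed set of indices $J$ such that (1) every pre-fixed point of $\mathcal E$ for $\sqsubseteq_{\mathrm{tr}}$ can be obtained from a pre-fixed point of $\mathcal E'$ for $\sqsubseteq_{\mathrm{tr}}$ by removing the components with indices in $J$, and (2) the same holds for post-fixed points. -}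

module Defs where

open import Data.Empty using (⊥)
open import Data.List.Base using (List; []; _∷_; _++_)
open import Data.List.Membership.Propositional using (_∈_)
open import Data.List.Relation.Unary.All using (All; lookup; tabulate) renaming (map to All-map)
open import Data.List.Relation.Unary.All.Properties using (lookup-map)
open import Data.List.Relation.Unary.Any using (here; there)
open import Data.Nat.Base using (ℕ; zero; suc; _≤_)
open import Data.Product.Base using (Σ-syntax; ∃; ∃-syntax; _×_; _,_)
open import Data.Unit.Base using (⊤)
open import Function.Bundles using (_↣_; _⇔_)
open import Relation.Binary.Construct.Closure.ReflexiveTransitive using (Star)
open import Relation.Binary.PropositionalEquality using (_≡_; refl; sym; trans; cong)
open import Relation.Nullary.Negation using (¬_)

-- The calculus is well-sorted: every name has a sort, and a name of sort s
-- carries tuples of names of sorts  ob s.  Constants are given with the sorts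
-- of their parameters.
--
-- Terms are well-scoped de Bruijn terms, so that α-equivalent terms are equal.
-- A scope has two parts: Φ, an arbitrary sorted set of free names (of any
-- size), and Γ, the finite list of names bound so far, either by an enclosing
-- binder or by an earlier transition.
module Syntax
  (Sort  : Set)
  (ob    : Sort → List Sort)
  (Const : List Sort → Set)
  where

  Arity Scope : Set
  Arity = List Sort
  Scope = List Sort

  Free : Set₁
  Free = Sort → Set

  ∅ : Free
  ∅ _ = ⊥

  data Name (Φ : Free) (Γ : Scope) (s : Sort) : Set where
    free  : Φ s → Name Φ Γ s
    local : s ∈ Γ → Name Φ Γ s

  -- Names of different sorts are different, so it is enough to compare
  -- components of the same sort.
  Distinct : ∀ {Φ Γ s̃} → All (Name Φ Γ) s̃ → Set
  Distinct {s̃ = s̃} as =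
    ∀ {s} (x y : s ∈ s̃) → lookup as x ≡ lookup as y → x ≡ y

  record Args (Φ : Free) (Γ : Scope) (s̃ : Arity) : Set where
    constructor args
    field
      names     : All (Name Φ Γ) s̃
      .distinct : Distinct names

  -- V is the family of equation variables, indexed by arity.
  --
  -- Agents are in normal form for application: ((x̃)P)⟨ã⟩ is identified with
  -- P{ã/x̃}, so that only constants and variables occur applied.
  -- The components of bound tuples are distinct by construction.
  data Proc (V : Arity → Set) (Φ : Free) (Γ : Scope) : Set where
    𝟘    : Proc V Φ Γ
    inp  : ∀ {s} → Name Φ Γ s → Proc V Φ (ob s ++ Γ) → Proc V Φ Γ
    out  : ∀ {s} → Name Φ Γ s → Proc V Φ (ob s ++ Γ) → Proc V Φ Γ
    ν    : ∀ s → Proc V Φ (s ∷ Γ) → Proc V Φ Γ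
    _∥_  : Proc V Φ Γ → Proc V Φ Γ → Proc V Φ Γ
    !inp : ∀ {s} → Name Φ Γ s → Proc V Φ (ob s ++ Γ) → Proc V Φ Γ
    con  : ∀ {s̃} → Const s̃ → Args Φ Γ s̃ → Proc V Φ Γ
    var  : ∀ {s̃} → V s̃ → Args Φ Γ s̃ → Proc V Φ Γ

  data Abs (V : Arity → Set) (Φ : Free) (s̃ : Arity) : Set where
    abs : Proc V Φ s̃ → Abs V Φ s̃
    con : Const s̃ → Abs V Φ s̃

  NoVar : Arity → Set
  NoVar _ = ⊥

  Process : Free → Scope → Set
  Process = Proc NoVar

  Abstraction : Free → Arity → Set
  Abstraction = Abs NoVar

  Expression : (Arity → Set) → Arity → Set
  Expression V = Abs V ∅

  Injective : ∀ {Φ Γ Ψ Δ} → (∀ {s} → Name Φ Γ s → Name Ψ Δ s) → Set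
  Injective {Φ} {Γ} f = ∀ {s} {a b : Name Φ Γ s} → f a ≡ f b → a ≡ b

  -- Only injective renamings act on terms, as these preserve the distinctness
  -- of tuples.
  record Ren (Φ : Free) (Γ : Scope) (Ψ : Free) (Δ : Scope) : Set where
    constructor ren
    field
      fun        : ∀ {s} → Name Φ Γ s → Name Ψ Δ s
      .injective : Injective fun

  open Ren public using (fun)

  idᵣ : ∀ {Φ Γ} → Ren Φ Γ Φ Γ
  idᵣ = ren (λ a → a) (λ eq → eq)

  infixr 9 _∘ᵣ_
  _∘ᵣ_ : ∀ {Φ Γ Ψ Δ Ξ Θ} → Ren Ψ Δ Ξ Θ → Ren Φ Γ Ψ Δ → Ren Φ Γ Ξ Θ
  ren g g-inj ∘ᵣ ren f f-inj = ren (λ a → g (f a)) (λ eq → f-inj (g-inj eq))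

  wk₁-name : ∀ {Φ Γ t s} → Name Φ Γ s → Name Φ (t ∷ Γ) s
  wk₁-name (free c)  = free c
  wk₁-name (local x) = local (there x)

  wk₁-injective : ∀ {Φ Γ t} → Injective {Φ} {Γ} (wk₁-name {t = t})
  wk₁-injective {a = free _}  {free _}  refl = refl
  wk₁-injective {a = local _} {local _} refl = refl

  wk₁ : ∀ {Φ Γ} t → Ren Φ Γ Φ (t ∷ Γ)
  wk₁ t = ren wk₁-name wk₁-injective

  wk : ∀ {Φ Γ} t̃ → Ren Φ Γ Φ (t̃ ++ Γ)
  wk []      = idᵣ
  wk (t ∷ t̃) = wk₁ t ∘ᵣ wk t̃

  module _ {Φ Γ Ψ Δ} (t : Sort) (f : ∀ {s} → Name Φ Γ s → Name Ψ Δ s) where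

    lift₁-name : ∀ {s} → Name Φ (t ∷ Γ) s → Name Ψ (t ∷ Δ) s
    lift₁-name (free c)          = wk₁-name (f (free c))
    lift₁-name (local (here p))  = local (here p)
    lift₁-name (local (there x)) = wk₁-name (f (local x))

    here≢wk₁ : ∀ {s} {p : s ≡ t} {a : Name Ψ Δ s} → ¬ (local (here p) ≡ wk₁-name a)
    here≢wk₁ {a = free _}  ()
    here≢wk₁ {a = local _} ()

    lift₁-injective : Injective f → Injective lift₁-name
    lift₁-injective inj {a = free _}          {free _}          eq = cong wk₁-name (inj (wk₁-injective eq))
    lift₁-injective inj {a = free _}          {local (there _)} eq = cong wk₁-name (inj (wk₁-injective eq))
    lift₁-injective inj {a = local (there _)} {free _}          eq = cong wk₁-name (inj (wk₁-injective eq))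
    lift₁-injective inj {a = local (there _)} {local (there _)} eq = cong wk₁-name (inj (wk₁-injective eq))
    lift₁-injective inj {a = local (here _)}  {local (here _)}  refl = refl
    lift₁-injective inj {a = free _}          {local (here _)}  eq with () ← here≢wk₁ (sym eq)
    lift₁-injective inj {a = local (there _)} {local (here _)}  eq with () ← here≢wk₁ (sym eq)
    lift₁-injective inj {a = local (here _)}  {free _}          eq with () ← here≢wk₁ eq
    lift₁-injective inj {a = local (here _)}  {local (there _)} eq with () ← here≢wk₁ eq

  lift₁ : ∀ {Φ Γ Ψ Δ} t → Ren Φ Γ Ψ Δ → Ren Φ (t ∷ Γ) Ψ (t ∷ Δ)
  lift₁ t (ren f f-inj) = ren (lift₁-name t f) (lift₁-injective t f f-inj)

  lift : ∀ {Φ Γ Ψ Δ} t̃ → Ren Φ Γ Ψ Δ → Ren Φ (t̃ ++ Γ) Ψ (t̃ ++ Δ)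
  lift []      ρ = ρ
  lift (t ∷ t̃) ρ = lift₁ t (lift t̃ ρ)

  swap₁-name : ∀ {Φ Γ t s r} → Name Φ (t ∷ s ∷ Γ) r → Name Φ (s ∷ t ∷ Γ) r
  swap₁-name (free c)                  = free c
  swap₁-name (local (here p))          = local (there (here p))
  swap₁-name (local (there (here p)))  = local (here p)
  swap₁-name (local (there (there x))) = local (there (there x))

  swap₁-involutive : ∀ {Φ Γ t s r} (a : Name Φ (t ∷ s ∷ Γ) r) → swap₁-name (swap₁-name a) ≡ a
  swap₁-involutive (free c)                  = refl
  swap₁-involutive (local (here p))          = refl
  swap₁-involutive (local (there (here p)))  = refl
  swap₁-involutive (local (there (there x))) = refl

  swap₁ : ∀ {Φ Γ} t s → Ren Φ (t ∷ s ∷ Γ) Φ (s ∷ t ∷ Γ)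
  swap₁ t s = ren swap₁-name λ {_} {a} {b} eq →
    trans (sym (swap₁-involutive a)) (trans (cong swap₁-name eq) (swap₁-involutive b))

  swap : ∀ {Φ Γ} t̃ s → Ren Φ (t̃ ++ s ∷ Γ) Φ (s ∷ t̃ ++ Γ)
  swap []      s = idᵣ
  swap (t ∷ t̃) s = swap₁ t s ∘ᵣ lift₁ t (swap t̃ s)

  map-distinct : ∀ {Φ Γ Ψ Δ s̃} (f : ∀ {s} → Name Φ Γ s → Name Ψ Δ s) → Injective f →
                 (as : All (Name Φ Γ) s̃) → Distinct as → Distinct (All-map f as)
  map-distinct f f-inj as as-dist x y eq =
    as-dist x y (f-inj (trans (sym (lookup-map as x)) (trans eq (lookup-map as y))))

  map-args : ∀ {Φ Γ Ψ Δ s̃} → Ren Φ Γ Ψ Δ → Args Φ Γ s̃ → Args Ψ Δ s̃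
  map-args (ren f f-inj) (args as as-dist) =
    args (All-map f as) (map-distinct f f-inj as as-dist)

  rename : ∀ {V Φ Γ Ψ Δ} → Ren Φ Γ Ψ Δ → Proc V Φ Γ → Proc V Ψ Δ
  rename ρ 𝟘                = 𝟘
  rename ρ (inp {s} a P)    = inp (fun ρ a) (rename (lift (ob s) ρ) P)
  rename ρ (out {s} a P)    = out (fun ρ a) (rename (lift (ob s) ρ) P)
  rename ρ (ν s P)          = ν s (rename (lift₁ s ρ) P)
  rename ρ (P ∥ Q)          = rename ρ P ∥ rename ρ Q
  rename ρ (!inp {s} a P)   = !inp (fun ρ a) (rename (lift (ob s) ρ) P)
  rename ρ (con K as)       = con K (map-args ρ as)
  rename ρ (var X as)       = var X (map-args ρ as)

  embed-name : ∀ {Φ Γ s} → Name ∅ Γ s → Name Φ Γ s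
  embed-name (local x) = local x

  -- {ã/x̃} for a body whose only free names are the parameters x̃.
  closed-name : ∀ {Φ Γ s̃} → All (Name Φ Γ) s̃ → ∀ {s} → Name ∅ s̃ s → Name Φ Γ s
  closed-name as (local x) = lookup as x

  closed-injective : ∀ {Φ Γ s̃} (as : All (Name Φ Γ) s̃) → Distinct as → Injective (closed-name as)
  closed-injective as as-dist {a = local x} {local y} eq = cong local (as-dist x y eq)

  closed-params : ∀ {Φ Γ s̃} → Args Φ Γ s̃ → Ren ∅ s̃ Φ Γ
  closed-params (args as as-dist) = ren (closed-name as) (closed-injective as as-dist)

  -- {ã/x̃} for a body with further free names, in Φ; the names ã are all bound
  -- in Γ, hence different from those in Φ.
  open-name : ∀ {Φ Γ s̃} → All (Name ∅ Γ) s̃ → ∀ {s} → Name Φ s̃ s → Name Φ Γ s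
  open-name as (free c)  = free c
  open-name as (local x) = embed-name (lookup as x)

  embed-injective : ∀ {Φ Γ} → Injective {∅} {Γ} {Φ} embed-name
  embed-injective {a = local _} {local _} refl = refl

  free≢embed : ∀ {Φ Γ s} {c : Φ s} (a : Name ∅ Γ s) → ¬ (free c ≡ embed-name {Φ} a)
  free≢embed (local _) ()

  open-injective : ∀ {Φ Γ s̃} (as : All (Name ∅ Γ) s̃) → Distinct as → Injective {Φ} (open-name as)
  open-injective as as-dist {a = free _}  {free _}  refl = refl
  open-injective as as-dist {a = local x} {local y} eq   = cong local (as-dist x y (embed-injective eq))
  open-injective as as-dist {a = free _}  {local y} eq with () ← free≢embed (lookup as y) eq
  open-injective as as-dist {a = local x} {free _}  eq with () ← free≢embed (lookup as x) (sym eq)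

  open-params : ∀ {Φ Γ s̃} → Args ∅ Γ s̃ → Ren Φ s̃ Φ Γ
  open-params (args as as-dist) = ren (open-name as) (open-injective as as-dist)

  embed : ∀ {Φ Γ} → Ren ∅ Γ Φ Γ
  embed = ren embed-name embed-injective

  infix 8 _⟨_⟩
  _⟨_⟩ : ∀ {V Φ Γ s̃} → Abs V Φ s̃ → Args ∅ Γ s̃ → Proc V Φ Γ
  abs P ⟨ as ⟩ = rename (open-params as) P
  con K ⟨ as ⟩ = con K (map-args embed as)

  lookup-tabulate-local : ∀ {Φ Γ s̃ s} (f : ∀ {r} → r ∈ s̃ → r ∈ Γ) (x : s ∈ s̃) →
    lookup (tabulate {P = Name Φ Γ} (λ y → local (f y))) x ≡ local (f x)
  lookup-tabulate-local f (here refl) = refl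
  lookup-tabulate-local f (there x)   = lookup-tabulate-local (λ y → f (there y)) x

  local-injective : ∀ {Φ Γ s} {x y : s ∈ Γ} → local {Φ} x ≡ local y → x ≡ y
  local-injective refl = refl

  fresh : ∀ {Φ s̃} → Args Φ s̃ s̃
  fresh = args (tabulate local) λ x y eq → local-injective
    (trans (sym (lookup-tabulate-local (λ z → z) x)) (trans eq (lookup-tabulate-local (λ z → z) y)))

  -- F⟨x̃⟩ for fresh x̃: the names x̃ form the scope of the resulting process.
  body : ∀ {V Φ s̃} → Abs V Φ s̃ → Proc V Φ s̃
  body (abs P) = P
  body (con K) = con K fresh

  Tuple : (Arity → Set) → Free → Set
  Tuple V Φ = ∀ {s̃} → V s̃ → Abstraction Φ s̃

  -- Replacement of X⟨ã⟩ by F⟨ã⟩. Expressions being name-closed, ã consists of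
  -- names bound in the expression, so no free name of F is captured.
  infix 8 _[_]ₚ _[_]
  _[_]ₚ : ∀ {V Φ Γ} → Proc V ∅ Γ → Tuple V Φ → Process Φ Γ
  𝟘         [ F ]ₚ = 𝟘
  inp a P   [ F ]ₚ = inp (embed-name a) (P [ F ]ₚ)
  out a P   [ F ]ₚ = out (embed-name a) (P [ F ]ₚ)
  ν s P     [ F ]ₚ = ν s (P [ F ]ₚ)
  (P ∥ Q)   [ F ]ₚ = (P [ F ]ₚ) ∥ (Q [ F ]ₚ)
  !inp a P  [ F ]ₚ = !inp (embed-name a) (P [ F ]ₚ)
  con K as  [ F ]ₚ = con K (map-args embed as)
  var X as  [ F ]ₚ = F X ⟨ as ⟩

  _[_] : ∀ {V Φ s̃} → Expression V s̃ → Tuple V Φ → Abstraction Φ s̃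
  abs P [ F ] = abs (P [ F ]ₚ)
  con K [ F ] = con K

  Guardedₚ : ∀ {V Φ Γ} → Proc V Φ Γ → Set
  Guardedₚ 𝟘          = ⊤
  Guardedₚ (inp a P)  = ⊤
  Guardedₚ (out a P)  = ⊤
  Guardedₚ (ν s P)    = Guardedₚ P
  Guardedₚ (P ∥ Q)    = Guardedₚ P × Guardedₚ Q
  Guardedₚ (!inp a P) = ⊤
  Guardedₚ (con K as) = ⊤
  Guardedₚ (var X as) = ⊥

  -- The index set I of {Xᵢ = Eᵢ} is presented as the family of its variables,
  -- sorted by arity.
  record System : Set₁ where
    field
      Var       : Arity → Set
      countable : ∃ Var ↣ ℕ
      rhs       : ∀ {s̃} → Var s̃ → Expression Var s̃

  open System public

  Guarded : System → Set
  Guarded 𝓔 = ∀ {s̃} (X : Var 𝓔 s̃) → Guardedₚ (body (rhs 𝓔 X))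

  data Visible (Φ : Free) (Γ : Scope) : Set where
    inp : ∀ {s} → Name Φ Γ s → Visible Φ Γ
    out : ∀ {s} → Name Φ Γ s → Visible Φ Γ

  data Action (Φ : Free) (Γ : Scope) : Set where
    τ   : Action Φ Γ
    vis : Visible Φ Γ → Action Φ Γ

  bnᵥ : ∀ {Φ Γ} → Visible Φ Γ → Scope
  bnᵥ (inp {s} a) = ob s
  bnᵥ (out {s} a) = ob s

  bn : ∀ {Φ Γ} → Action Φ Γ → Scope
  bn τ       = []
  bn (vis α) = bnᵥ α

  wk-actionᵥ : ∀ {Φ Γ} t → Visible Φ Γ → Visible Φ (t ∷ Γ)
  wk-actionᵥ t (inp a) = inp (wk₁-name a)
  wk-actionᵥ t (out a) = out (wk₁-name a)

  wk-action : ∀ {Φ Γ} t → Action Φ Γ → Action Φ (t ∷ Γ)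
  wk-action t τ       = τ
  wk-action t (vis α) = vis (wk-actionᵥ t α)

  swap-bn : ∀ {Φ Γ t} (μ : Action Φ Γ) →
            Process Φ (bn (wk-action t μ) ++ t ∷ Γ) → Process Φ (t ∷ bn μ ++ Γ)
  swap-bn         τ                 P = P
  swap-bn {t = t} (vis (inp {s} a)) P = rename (swap (ob s) t) P
  swap-bn {t = t} (vis (out {s} a)) P = rename (swap (ob s) t) P

  ν* : ∀ {Φ Γ} t̃ → Process Φ (t̃ ++ Γ) → Process Φ Γ
  ν* []      P = P
  ν* (t ∷ t̃) P = ν* t̃ (ν t P)

  -- K ≜ (x̃)P with (x̃)P name-closed is given by  def K = P.
  module Semantics (def : ∀ {s̃} → Const s̃ → Process ∅ s̃) where

    -- The bound names of an action are new in the scope of the derivative. The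
    -- side conditions on bound names thus become weakenings; in res the action
    -- does not mention the restricted name as it is weakened by it.
    infix 4 _—[_]→_
    data _—[_]→_ {Φ : Free} {Γ : Scope} :
         Process Φ Γ → (μ : Action Φ Γ) → Process Φ (bn μ ++ Γ) → Set where
      inp  : ∀ {s} {a : Name Φ Γ s} {P} → inp a P —[ vis (inp a) ]→ P
      out  : ∀ {s} {a : Name Φ Γ s} {P} → out a P —[ vis (out a) ]→ P
      rep  : ∀ {s} {a : Name Φ Γ s} {P} →
             !inp a P —[ vis (inp a) ]→ P ∥ rename (wk (ob s)) (!inp a P)
      parˡ : ∀ {P Q μ P′} → P —[ μ ]→ P′ → P ∥ Q —[ μ ]→ P′ ∥ rename (wk (bn μ)) Q
      parʳ : ∀ {P Q μ Q′} → Q —[ μ ]→ Q′ → P ∥ Q —[ μ ]→ rename (wk (bn μ)) P ∥ Q′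
      comˡ : ∀ {s} {a : Name Φ Γ s} {P Q P′ Q′} →
             P —[ vis (inp a) ]→ P′ → Q —[ vis (out a) ]→ Q′ →
             P ∥ Q —[ τ ]→ ν* (ob s) (P′ ∥ Q′)
      comʳ : ∀ {s} {a : Name Φ Γ s} {P Q P′ Q′} →
             P —[ vis (out a) ]→ P′ → Q —[ vis (inp a) ]→ Q′ →
             P ∥ Q —[ τ ]→ ν* (ob s) (P′ ∥ Q′)
      res  : ∀ {t P μ P′} → P —[ wk-action t μ ]→ P′ → ν t P —[ μ ]→ ν t (swap-bn μ P′)
      cst  : ∀ {s̃} {K : Const s̃} {as : Args Φ Γ s̃} {μ P′} →
             rename (closed-params as) (def K) —[ μ ]→ P′ → con K as —[ μ ]→ P′

    infix 4 _⟹_ _⟹[_]_ _⟹⟨_⟩ _⊑ₚ_ _⊑tr_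

    _⟹_ : ∀ {Φ Γ} → Process Φ Γ → Process Φ Γ → Set
    _⟹_ = Star (λ P P′ → P —[ τ ]→ P′)

    _⟹[_]_ : ∀ {Φ Γ} → Process Φ Γ → (α : Visible Φ Γ) → Process Φ (bnᵥ α ++ Γ) → Set
    P ⟹[ α ] P′ = ∃[ P₁ ] ∃[ P₂ ] (P ⟹ P₁ × P₁ —[ vis α ]→ P₂ × P₂ ⟹ P′)

    -- Names bound by an action of a trace may be used by the later ones.
    data Trace (Φ : Free) (Γ : Scope) : Set where
      []  : Trace Φ Γ
      _∷_ : (α : Visible Φ Γ) → Trace Φ (bnᵥ α ++ Γ) → Trace Φ Γ

    _⟹⟨_⟩ : ∀ {Φ Γ} → Process Φ Γ → Trace Φ Γ → Set
    P ⟹⟨ [] ⟩    = ⊤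
    P ⟹⟨ α ∷ s ⟩ = ∃[ P′ ] (P ⟹[ α ] P′ × P′ ⟹⟨ s ⟩)

    _⊑ₚ_ : ∀ {Φ Γ} → Process Φ Γ → Process Φ Γ → Set
    P ⊑ₚ Q = ∀ s → P ⟹⟨ s ⟩ → Q ⟹⟨ s ⟩

    _⊑tr_ : ∀ {Φ s̃} → Abstraction Φ s̃ → Abstraction Φ s̃ → Set
    F ⊑tr G = body F ⊑ₚ body G

    State : Free → Set
    State Φ = Σ[ Γ ∈ Scope ] Process Φ Γ

    data _—→_ {Φ : Free} : State Φ → State Φ → Set where
      step : ∀ {Γ} {P : Process Φ Γ} μ {P′} → P —[ μ ]→ P′ → (Γ , P) —→ (bn μ ++ Γ , P′)

    Silent : ∀ {Φ} {S S′ : State Φ} → S —→ S′ → Set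
    Silent (step τ       _) = ⊤
    Silent (step (vis α) _) = ⊥

    record Divergesₚ {Φ : Free} {Γ : Scope} (P : Process Φ Γ) : Set where
      field
        state : ℕ → State Φ
        start : state zero ≡ (Γ , P)
        steps : ∀ n → state n —→ state (suc n)
        bound : ℕ
        taus  : ∀ n → bound ≤ n → Silent (steps n)

    Diverges : ∀ {Φ s̃} → Abstraction Φ s̃ → Set
    Diverges F = Divergesₚ (body F)

    IsSyntacticSolution : (𝓔 : System) → (∀ {s̃} → Var 𝓔 s̃ → Const s̃) → Set
    IsSyntacticSolution 𝓔 K = ∀ {s̃} (X : Var 𝓔 s̃) → def (K X) ≡ body (rhs 𝓔 X [ (λ Y → con (K Y)) ])

    PreFixedPoint : ∀ {Φ} (𝓔 : System) → Tuple (Var 𝓔) Φ → Set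
    PreFixedPoint 𝓔 F = ∀ {s̃} (X : Var 𝓔 s̃) → rhs 𝓔 X [ F ] ⊑tr F X

    PostFixedPoint : ∀ {Φ} (𝓔 : System) → Tuple (Var 𝓔) Φ → Set
    PostFixedPoint 𝓔 F = ∀ {s̃} (X : Var 𝓔 s̃) → F X ⊑tr rhs 𝓔 X [ F ]

    -- 𝓔′ extends 𝓔. The map ι identifies the indices of 𝓔 with those of 𝓔′ that
    -- are not in J; the tuple F′ ∘ ι is F′ without its components in J.
    record Extends (Φ : Free) (𝓔′ 𝓔 : System) : Set₁ where
      field
        J           : ∀ {s̃} → Var 𝓔′ s̃ → Set
        ι           : ∀ {s̃} → Var 𝓔 s̃ → Var 𝓔′ s̃
        ι-injective : ∀ {s̃} {X Y : Var 𝓔 s̃} → ι X ≡ ι Y → X ≡ Y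
        ι-image     : ∀ {s̃} (X′ : Var 𝓔′ s̃) → (¬ J X′) ⇔ (∃[ X ] ι X ≡ X′)
        pre         : (F : Tuple (Var 𝓔) Φ) → PreFixedPoint 𝓔 F →
                      Σ[ F′ ∈ Tuple (Var 𝓔′) Φ ]
                        PreFixedPoint 𝓔′ F′ × (∀ {s̃} (X : Var 𝓔 s̃) → F X ≡ F′ (ι X))
        post        : (F : Tuple (Var 𝓔) Φ) → PostFixedPoint 𝓔 F →
                      Σ[ F′ ∈ Tuple (Var 𝓔′) Φ ]
                        PostFixedPoint 𝓔′ F′ × (∀ {s̃} (X : Var 𝓔 s̃) → F X ≡ F′ (ι X))

{-# OPTIONS --safe #-}
module Submission where

-- By the extension hypothesis it is enough to treat a guarded system 𝓔 with a
-- non-divergent syntactic solution K, a post-fixed point F and a pre-fixed point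
-- G. We show that C[F] ⟹⟨ u ⟩ implies C[G] ⟹⟨ u ⟩ for every context C such that
-- C[K] is reachable, up to unfolding, from the solution. Let C′ be C with each
-- unguarded variable X replaced by its right-hand side. As ⊑tr is preserved by
-- parallel composition, restriction and injective renaming, C[F] ⊑ C′[F] and
-- C′[G] ⊑ C[G]. As C′ is guarded, the first step of the run of C′[F] is made by
-- C′ alone, hence also by C′[G] and C′[K]. It either shortens u or is a τ-step of
-- the solution, and only finitely many of the latter occur in a row.

open import Axiom.ExcludedMiddle using (ExcludedMiddle)
open import Data.Empty using (⊥-elim)
open import Data.List.Base using (List; []; _∷_; _++_)
open import Data.List.Membership.Propositional using (_∈_)
open import Data.List.Relation.Unary.All using (All; []; _∷_; lookup; tabulate)
open import Data.List.Relation.Unary.All.Properties using (lookup-map; map-cong; map-id; map-∘)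
open import Data.List.Relation.Unary.Any using (here; there)
open import Data.Nat.Base using (ℕ; zero; suc; s≤s)
open import Data.Product.Base using (∃-syntax; _×_; _,_; proj₁; proj₂)
open import Data.Unit.Base using (tt)
open import Induction.WellFounded using (Acc; acc)
open import Level using (0ℓ)
open import Relation.Binary.Construct.Closure.ReflexiveTransitive using (ε; _◅_; gmap)
open import Relation.Binary.PropositionalEquality
  using (_≡_; refl; sym; trans; cong; cong₂; subst)
open import Relation.Nullary using (yes; no; recompute)
open import Relation.Nullary.Negation using (¬_)
open import Defs

-- Laws of injective renamings and their action on names, terms and actions.

module Renaming (Sort : Set) (ob : Sort → List Sort) (Const : List Sort → Set) where

  open Syntax Sort ob Const

  private variable
    Φ Ψ Ξ : Free
    Γ Δ Θ : Scope
    s t : Sort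
    s̃ : Arity
    V : Arity → Set

  infix 4 _≗_
  _≗_ : Ren Φ Γ Ψ Δ → Ren Φ Γ Ψ Δ → Set
  _≗_ {Φ} {Γ} ρ σ = ∀ {s} (a : Name Φ Γ s) → fun ρ a ≡ fun σ a

  -- `free` and `local (there _)` names both come from the smaller scope and behave alike under
  -- lifting; the view merges the two cases.
  data Wk₁View {Φ : Free} {Γ : Scope} {s t : Sort} : Name Φ (t ∷ Γ) s → Set where
    new : (p : s ≡ t) → Wk₁View (local (here p))
    old : (a : Name Φ Γ s) → Wk₁View (wk₁-name a)

  wk₁-view : (a : Name Φ (t ∷ Γ) s) → Wk₁View a
  wk₁-view (free c)          = old (free c)
  wk₁-view (local (here p))  = new p
  wk₁-view (local (there x)) = old (local x)

  lift₁-wk₁ : (ρ : Ren Φ Γ Ψ Δ) (a : Name Φ Γ s) →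
              fun (lift₁ t ρ) (wk₁-name a) ≡ wk₁-name (fun ρ a)
  lift₁-wk₁ ρ (free c)  = refl
  lift₁-wk₁ ρ (local x) = refl

  lift₁-id : (ρ : Ren Φ Γ Φ Γ) → ρ ≗ idᵣ → lift₁ t ρ ≗ idᵣ
  lift₁-id ρ eq a with wk₁-view a
  ... | new p = refl
  ... | old b = trans (lift₁-wk₁ ρ b) (cong wk₁-name (eq b))

  lift-id : ∀ t̃ (ρ : Ren Φ Γ Φ Γ) → ρ ≗ idᵣ → lift t̃ ρ ≗ idᵣ
  lift-id []      ρ eq = eq
  lift-id (t ∷ t̃) ρ eq = lift₁-id (lift t̃ ρ) (lift-id t̃ ρ eq)

  lift₁-∘ : (σ : Ren Ψ Δ Ξ Θ) (ρ : Ren Φ Γ Ψ Δ) (χ : Ren Φ Γ Ξ Θ) →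
            σ ∘ᵣ ρ ≗ χ → lift₁ t σ ∘ᵣ lift₁ t ρ ≗ lift₁ t χ
  lift₁-∘ {t = t} σ ρ χ eq a with wk₁-view a
  ... | new p = refl
  ... | old b = trans (cong (fun (lift₁ t σ)) (lift₁-wk₁ ρ b))
               (trans (lift₁-wk₁ σ (fun ρ b))
               (trans (cong wk₁-name (eq b)) (sym (lift₁-wk₁ χ b))))

  lift-∘ : ∀ t̃ (σ : Ren Ψ Δ Ξ Θ) (ρ : Ren Φ Γ Ψ Δ) (χ : Ren Φ Γ Ξ Θ) →
           σ ∘ᵣ ρ ≗ χ → lift t̃ σ ∘ᵣ lift t̃ ρ ≗ lift t̃ χ
  lift-∘ []      σ ρ χ eq = eq
  lift-∘ (t ∷ t̃) σ ρ χ eq = lift₁-∘ (lift t̃ σ) (lift t̃ ρ) (lift t̃ χ) (lift-∘ t̃ σ ρ χ eq)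

  -- Distinctness is an irrelevant field, so it imposes no equation of its own.
  args-≡ : {as bs : Args Φ Γ s̃} → Args.names as ≡ Args.names bs → as ≡ bs
  args-≡ {as = args _ _} {args _ _} refl = refl

  map-args-id : (ρ : Ren Φ Γ Φ Γ) → ρ ≗ idᵣ → (as : Args Φ Γ s̃) → map-args ρ as ≡ as
  map-args-id ρ eq (args as _) = args-≡ (trans (map-cong as eq) (map-id as))

  map-args-∘ : (σ : Ren Ψ Δ Ξ Θ) (ρ : Ren Φ Γ Ψ Δ) (χ : Ren Φ Γ Ξ Θ) →
               σ ∘ᵣ ρ ≗ χ → (as : Args Φ Γ s̃) → map-args σ (map-args ρ as) ≡ map-args χ as
  map-args-∘ σ ρ χ eq (args as _) = args-≡ (trans (map-∘ as) (map-cong as eq))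

  -- The hypothesis is pointwise because `idᵣ` lifted under a binder agrees with `idᵣ` on every name
  -- without being definitionally equal to it. The composition law has a separate `χ` for the same
  -- reason.
  rename-id : (ρ : Ren Φ Γ Φ Γ) → ρ ≗ idᵣ → (P : Proc V Φ Γ) → rename ρ P ≡ P
  rename-id ρ eq 𝟘              = refl
  rename-id ρ eq (inp {s} a P)  = cong₂ inp (eq a) (rename-id (lift (ob s) ρ) (lift-id (ob s) ρ eq) P)
  rename-id ρ eq (out {s} a P)  = cong₂ out (eq a) (rename-id (lift (ob s) ρ) (lift-id (ob s) ρ eq) P)
  rename-id ρ eq (ν s P)        = cong (ν s) (rename-id (lift₁ s ρ) (lift₁-id ρ eq) P)
  rename-id ρ eq (P ∥ Q)        = cong₂ _∥_ (rename-id ρ eq P) (rename-id ρ eq Q)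
  rename-id ρ eq (!inp {s} a P) = cong₂ !inp (eq a) (rename-id (lift (ob s) ρ) (lift-id (ob s) ρ eq) P)
  rename-id ρ eq (con K as)     = cong (con K) (map-args-id ρ eq as)
  rename-id ρ eq (var X as)     = cong (var X) (map-args-id ρ eq as)

  rename-∘ : (σ : Ren Ψ Δ Ξ Θ) (ρ : Ren Φ Γ Ψ Δ) (χ : Ren Φ Γ Ξ Θ) →
             σ ∘ᵣ ρ ≗ χ → (P : Proc V Φ Γ) → rename σ (rename ρ P) ≡ rename χ P
  rename-∘ σ ρ χ eq 𝟘              = refl
  rename-∘ σ ρ χ eq (inp {s} a P)  = cong₂ inp (eq a) (rename-∘ _ _ _ (lift-∘ (ob s) σ ρ χ eq) P)
  rename-∘ σ ρ χ eq (out {s} a P)  = cong₂ out (eq a) (rename-∘ _ _ _ (lift-∘ (ob s) σ ρ χ eq) P)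
  rename-∘ σ ρ χ eq (ν s P)        = cong (ν s) (rename-∘ _ _ _ (lift₁-∘ σ ρ χ eq) P)
  rename-∘ σ ρ χ eq (P ∥ Q)        = cong₂ _∥_ (rename-∘ σ ρ χ eq P) (rename-∘ σ ρ χ eq Q)
  rename-∘ σ ρ χ eq (!inp {s} a P) = cong₂ !inp (eq a) (rename-∘ _ _ _ (lift-∘ (ob s) σ ρ χ eq) P)
  rename-∘ σ ρ χ eq (con K as)     = cong (con K) (map-args-∘ σ ρ χ eq as)
  rename-∘ σ ρ χ eq (var X as)     = cong (var X) (map-args-∘ σ ρ χ eq as)

  rename-cong : (ρ σ : Ren Φ Γ Ψ Δ) → ρ ≗ σ → (P : Proc V Φ Γ) → rename ρ P ≡ rename σ P
  rename-cong ρ σ eq P =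
    -- The composition law at `ρ ∘ᵣ idᵣ ≗ σ` saves a further induction on terms.
    trans (cong (rename ρ) (sym (rename-id idᵣ (λ _ → refl) P))) (rename-∘ ρ idᵣ σ eq P)

  rename-square : (σ′ : Ren Ψ Δ Ξ Θ) (ρ : Ren Φ Γ Ψ Δ) →
                  ∀ {Ω Λ} (ρ′ : Ren Ω Λ Ξ Θ) (σ : Ren Φ Γ Ω Λ) →
                  σ′ ∘ᵣ ρ ≗ ρ′ ∘ᵣ σ → (P : Proc V Φ Γ) →
                  rename σ′ (rename ρ P) ≡ rename ρ′ (rename σ P)
  rename-square σ′ ρ ρ′ σ eq P =
    trans (rename-∘ σ′ ρ (ρ′ ∘ᵣ σ) eq P) (sym (rename-∘ ρ′ σ (ρ′ ∘ᵣ σ) (λ _ → refl) P))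

  wk-natural : ∀ t̃ (ρ : Ren Φ Γ Ψ Δ) → lift t̃ ρ ∘ᵣ wk t̃ ≗ wk t̃ ∘ᵣ ρ
  wk-natural []      ρ a = refl
  wk-natural (t ∷ t̃) ρ a =
    trans (lift₁-wk₁ (lift t̃ ρ) (fun (wk t̃) a)) (cong wk₁-name (wk-natural t̃ ρ a))

  swap₁-wk₁-wk₁ : ∀ {r} (a : Name Φ Γ r) →
                  swap₁-name {t = t} {s} (wk₁-name (wk₁-name a)) ≡ wk₁-name (wk₁-name a)
  swap₁-wk₁-wk₁ (free c)  = refl
  swap₁-wk₁-wk₁ (local x) = refl

  swap₁-natural : (ρ : Ren Φ Γ Ψ Δ) →
                  swap₁ t s ∘ᵣ lift₁ t (lift₁ s ρ) ≗ lift₁ s (lift₁ t ρ) ∘ᵣ swap₁ t s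
  swap₁-natural ρ (free c)                  = swap₁-wk₁-wk₁ (fun ρ (free c))
  swap₁-natural ρ (local (here p))          = refl
  swap₁-natural ρ (local (there (here p)))  = refl
  swap₁-natural ρ (local (there (there x))) = swap₁-wk₁-wk₁ (fun ρ (local x))

  swap-natural : ∀ t̃ s (ρ : Ren Φ Γ Ψ Δ) →
                 swap t̃ s ∘ᵣ lift t̃ (lift₁ s ρ) ≗ lift₁ s (lift t̃ ρ) ∘ᵣ swap t̃ s
  swap-natural []      s ρ a = refl
  swap-natural (t ∷ t̃) s ρ a =
    trans (cong (fun (swap₁ t s)) (trans
            (lift₁-∘ (swap t̃ s) (lift t̃ (lift₁ s ρ)) (lift₁ s (lift t̃ ρ) ∘ᵣ swap t̃ s)
                     (swap-natural t̃ s ρ) a)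
            (sym (lift₁-∘ (lift₁ s (lift t̃ ρ)) (swap t̃ s) (lift₁ s (lift t̃ ρ) ∘ᵣ swap t̃ s)
                          (λ _ → refl) a))))
          (swap₁-natural (lift t̃ ρ) (fun (lift₁ t (swap t̃ s)) a))

  rename-ν* : ∀ t̃ (ρ : Ren Φ Γ Ψ Δ) (P : Process Φ (t̃ ++ Γ)) →
              rename ρ (ν* t̃ P) ≡ ν* t̃ (rename (lift t̃ ρ) P)
  rename-ν* []      ρ P = refl
  rename-ν* (t ∷ t̃) ρ P = rename-ν* t̃ ρ (ν t P)

  closed-params-natural : (ρ : Ren Φ Γ Ψ Δ) (as : Args Φ Γ s̃) →
                          ρ ∘ᵣ closed-params as ≗ closed-params (map-args ρ as)
  closed-params-natural ρ (args as _) (local x) = sym (lookup-map as x)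

  rename-closed : (ρ : Ren Φ Γ Ψ Δ) (as : Args Φ Γ s̃) (P : Process ∅ s̃) →
                  rename ρ (rename (closed-params as) P) ≡ rename (closed-params (map-args ρ as)) P
  rename-closed ρ as = rename-∘ ρ (closed-params as) _ (closed-params-natural ρ as)

  -- μ′ is the image of μ under ρ. As a relation, rather than a function on
  -- actions, it determines bn μ′ from bn μ by matching.
  infix 4 _⊢_↦_
  data _⊢_↦_ (ρ : Ren Φ Γ Ψ Δ) : Action Φ Γ → Action Ψ Δ → Set where
    τ   : ρ ⊢ τ ↦ τ
    inp : {a : Name Φ Γ s} {b : Name Ψ Δ s} → fun ρ a ≡ b → ρ ⊢ vis (inp a) ↦ vis (inp b)
    out : {a : Name Φ Γ s} {b : Name Ψ Δ s} → fun ρ a ≡ b → ρ ⊢ vis (out a) ↦ vis (out b)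

  private variable
    μ  : Action Φ Γ
    μ′ : Action Ψ Δ

  lift-bn : {ρ : Ren Φ Γ Ψ Δ} → ρ ⊢ μ ↦ μ′ → Ren Φ (bn μ ++ Γ) Ψ (bn μ′ ++ Δ)
  lift-bn {ρ = ρ} τ           = ρ
  lift-bn {ρ = ρ} (inp {s} _) = lift (ob s) ρ
  lift-bn {ρ = ρ} (out {s} _) = lift (ob s) ρ

  wk-bn-natural : {ρ : Ren Φ Γ Ψ Δ} (m : ρ ⊢ μ ↦ μ′) →
                  lift-bn m ∘ᵣ wk (bn μ) ≗ wk (bn μ′) ∘ᵣ ρ
  wk-bn-natural         τ           a = refl
  wk-bn-natural {ρ = ρ} (inp {s} _) a = wk-natural (ob s) ρ a
  wk-bn-natural {ρ = ρ} (out {s} _) a = wk-natural (ob s) ρ a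

  wk-↦ : ∀ t {ρ : Ren Φ Γ Ψ Δ} → ρ ⊢ μ ↦ μ′ → lift₁ t ρ ⊢ wk-action t μ ↦ wk-action t μ′
  wk-↦ t         τ                = τ
  wk-↦ t {ρ = ρ} (inp {a = a} eq) = inp (trans (lift₁-wk₁ ρ a) (cong wk₁-name eq))
  wk-↦ t {ρ = ρ} (out {a = a} eq) = out (trans (lift₁-wk₁ ρ a) (cong wk₁-name eq))

  swap-bn-natural : {ρ : Ren Φ Γ Ψ Δ} (m : ρ ⊢ μ ↦ μ′) (P : Process Φ (bn (wk-action t μ) ++ t ∷ Γ)) →
                    swap-bn μ′ (rename (lift-bn (wk-↦ t m)) P) ≡ rename (lift₁ t (lift-bn m)) (swap-bn μ P)
  swap-bn-natural                 τ           P = refl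
  swap-bn-natural {t = t} {ρ = ρ} (inp {s} _) P =
    rename-square _ _ _ (swap (ob s) t) (swap-natural (ob s) t ρ) P
  swap-bn-natural {t = t} {ρ = ρ} (out {s} _) P =
    rename-square _ _ _ (swap (ob s) t) (swap-natural (ob s) t ρ) P

  -- A lifted renaming fixes the new name, which is never a weakened one. This recovers the side
  -- condition of `res` when a step is pulled back along a renaming.
  unlift₁ : (ρ : Ren Φ Γ Ψ Δ) (a : Name Φ (t ∷ Γ) s) {b : Name Ψ Δ s} →
            fun (lift₁ t ρ) a ≡ wk₁-name b → ∃[ a₀ ] a ≡ wk₁-name a₀ × fun ρ a₀ ≡ b
  unlift₁ {t = t} ρ a eq with wk₁-view a
  ... | new p with () ← here≢wk₁ t (fun ρ) eq
  ... | old a₀ = a₀ , refl , wk₁-injective (trans (sym (lift₁-wk₁ ρ a₀)) eq)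

module Steps (em : ExcludedMiddle 0ℓ)
             (Sort : Set) (ob : Sort → List Sort) (Const : List Sort → Set)
             (def : ∀ {s̃} → Const s̃ → Syntax.Process Sort ob Const (Syntax.∅ Sort ob Const) s̃) where

  open Syntax Sort ob Const
  open Semantics def
  open Renaming Sort ob Const

  private variable
    Φ Ψ : Free
    Γ Δ : Scope
    μ  : Action Φ Γ
    μ′ : Action Ψ Δ
    P P′ Q R R′ : Process Φ Γ

  -- Transitions of renamed processes.

  step-target : R ≡ R′ → P —[ μ ]→ R → P —[ μ ]→ R′
  step-target refl d = d

  step-source : P ≡ Q → Q —[ μ ]→ R → P —[ μ ]→ R
  step-source refl d = d

  rename-step : {ρ : Ren Φ Γ Ψ Δ} (m : ρ ⊢ μ ↦ μ′) →
                P —[ μ ]→ P′ → rename ρ P —[ μ′ ]→ rename (lift-bn m) P′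
  rename-step (inp refl) inp = inp
  rename-step (out refl) out = out
  rename-step {ρ = ρ} (inp refl) (rep {s} {a} {P}) =
    step-target (cong (rename (lift (ob s) ρ) P ∥_) (sym (rename-square _ _ (wk (ob s)) ρ (wk-natural (ob s) ρ) (!inp a P)))) rep
  rename-step {ρ = ρ} m (parˡ {Q = Q} d) =
    step-target (cong (_ ∥_) (sym (rename-square _ _ _ ρ (wk-bn-natural m) Q))) (parˡ (rename-step m d))
  rename-step {ρ = ρ} m (parʳ {P = P} d) =
    step-target (cong (_∥ _) (sym (rename-square _ _ _ ρ (wk-bn-natural m) P))) (parʳ (rename-step m d))
  rename-step {ρ = ρ} τ (comˡ {s} d e) =
    step-target (sym (rename-ν* (ob s) ρ _)) (comˡ (rename-step (inp refl) d) (rename-step (out refl) e))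
  rename-step {ρ = ρ} τ (comʳ {s} d e) =
    step-target (sym (rename-ν* (ob s) ρ _)) (comʳ (rename-step (out refl) d) (rename-step (inp refl) e))
  rename-step m (res {t} {P′ = P′} d) =
    step-target (cong (ν t) (swap-bn-natural m P′)) (res (rename-step (wk-↦ t m) d))
  rename-step {ρ = ρ} m (cst {K = K} {as} d) =
    cst (step-source (sym (rename-closed ρ as (def K))) (rename-step m d))

  -- Injectivity is an irrelevant field of Ren; excluded middle recovers it.
  fun-injective : (ρ : Ren Φ Γ Ψ Δ) {s : Sort} {a b : Name Φ Γ s} → fun ρ a ≡ fun ρ b → a ≡ b
  fun-injective (ren f f-injective) eq = recompute em (f-injective eq)

  record Preimage (ρ : Ren Φ Γ Ψ Δ) (P : Process Φ Γ)
                  (μ′ : Action Ψ Δ) (R : Process Ψ (bn μ′ ++ Δ)) : Set where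
    constructor preimage
    field
      {action}   : Action Φ Γ
      {target}   : Process Φ (bn action ++ Γ)
      image      : ρ ⊢ action ↦ μ′
      derivation : P —[ action ]→ target
      target≡    : R ≡ rename (lift-bn image) target

  unres-step : ∀ {t} {ρ : Ren Φ Γ Ψ Δ} {P μ′ R} →
               Preimage (lift₁ t ρ) P (wk-action t μ′) R → Preimage ρ (ν t P) μ′ (ν t (swap-bn μ′ R))
  unres-step {t = t} {μ′ = τ} (preimage τ d refl) = preimage τ (res d) refl
  unres-step {t = t} {ρ = ρ} {μ′ = vis (inp b)} (preimage (inp {a = a} eq) d refl)
    with unlift₁ ρ a eq
  ... | _ , refl , eq₀ = preimage (inp eq₀) (res d) (cong (ν t) (swap-bn-natural (inp eq₀) _))
  unres-step {t = t} {ρ = ρ} {μ′ = vis (out b)} (preimage (out {a = a} eq) d refl)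
    with unlift₁ ρ a eq
  ... | _ , refl , eq₀ = preimage (out eq₀) (res d) (cong (ν t) (swap-bn-natural (out eq₀) _))

  -- The process making the step is only equal to rename ρ P, so that the
  -- recursion is on the derivation, as unfolding a constant requires.
  unrename-step : (ρ : Ren Φ Γ Ψ Δ) (P : Process Φ Γ) → Q ≡ rename ρ P → Q —[ μ′ ]→ R →
                  Preimage ρ P μ′ R
  unrename-step ρ (inp a P) refl inp = preimage (inp refl) inp refl
  unrename-step ρ (out a P) refl out = preimage (out refl) out refl
  unrename-step ρ (!inp {s} a P) refl rep =
    preimage (inp refl) rep
      (cong (rename (lift (ob s) ρ) P ∥_) (sym (rename-square _ _ (wk (ob s)) ρ (wk-natural (ob s) ρ) (!inp a P))))
  unrename-step ρ (P ∥ Q) refl (parˡ d) with unrename-step ρ P refl d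
  ... | preimage m d₀ refl =
    preimage m (parˡ d₀) (cong (_ ∥_) (sym (rename-square _ _ _ ρ (wk-bn-natural m) Q)))
  unrename-step ρ (P ∥ Q) refl (parʳ d) with unrename-step ρ Q refl d
  ... | preimage m d₀ refl =
    preimage m (parʳ d₀) (cong (_∥ _) (sym (rename-square _ _ _ ρ (wk-bn-natural m) P)))
  unrename-step ρ (P ∥ Q) refl (comˡ {s} d e)
    with unrename-step ρ P refl d | unrename-step ρ Q refl e
  ... | preimage (inp eq) d₀ refl | preimage (out eq′) e₀ refl
    -- The partners share a subject after renaming; by injectivity they shared it before, so the
    -- communication itself pulls back.
    with refl ← fun-injective ρ (trans eq (sym eq′)) =
    preimage τ (comˡ d₀ e₀) (sym (rename-ν* (ob s) ρ _))
  unrename-step ρ (P ∥ Q) refl (comʳ {s} d e)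
    with unrename-step ρ P refl d | unrename-step ρ Q refl e
  ... | preimage (out eq) d₀ refl | preimage (inp eq′) e₀ refl
    with refl ← fun-injective ρ (trans eq (sym eq′)) =
    preimage τ (comʳ d₀ e₀) (sym (rename-ν* (ob s) ρ _))
  unrename-step ρ (ν t P) refl (res d) = unres-step (unrename-step (lift₁ t ρ) P refl d)
  unrename-step ρ (con K as) refl (cst d) with unrename-step ρ _ (sym (rename-closed ρ as (def K))) d
  ... | preimage m d₀ eq = preimage m (cst d₀) eq

  -- Runs and their decomposition through the operators.

  private variable
    α : Visible Φ Γ
    u v : Trace Φ Γ
    n : ℕ

  -- The length bound is the termination measure of par-through, which recurses
  -- on runs from which the restrictions created by a communication are stripped.
  data Run {Φ} {Γ} : ℕ → Process Φ Γ → Trace Φ Γ → Set where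
    done : Run n P []
    tau  : P —[ τ ]→ P′ → Run n P′ u → Run (suc n) P u
    act  : P —[ vis α ]→ P′ → Run n P′ u → Run (suc n) P (α ∷ u)

  τ-trace : P —[ τ ]→ P′ → P′ ⟹⟨ u ⟩ → P ⟹⟨ u ⟩
  τ-trace {u = []}    d h                                  = tt
  τ-trace {u = α ∷ u} d (P″ , (P₁ , P₂ , ds , e , es) , h) = P″ , (P₁ , P₂ , d ◅ ds , e , es) , h

  τ*-trace : P ⟹ P′ → P′ ⟹⟨ u ⟩ → P ⟹⟨ u ⟩
  τ*-trace ε        h = h
  τ*-trace (d ◅ ds) h = τ-trace d (τ*-trace ds h)

  act-trace : P —[ vis α ]→ P′ → P′ ⟹⟨ u ⟩ → P ⟹⟨ α ∷ u ⟩
  act-trace d h = _ , (_ , _ , ε , d , ε) , h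

  run⇒trace : Run n P u → P ⟹⟨ u ⟩
  run⇒trace done      = tt
  run⇒trace (tau d r) = τ-trace d (run⇒trace r)
  run⇒trace (act d r) = act-trace d (run⇒trace r)

  τ*-run : P ⟹ P′ → Run n P′ u → ∃[ m ] Run m P u
  τ*-run ε        r = _ , r
  τ*-run (d ◅ ds) r = _ , tau d (proj₂ (τ*-run ds r))

  trace⇒run : (u : Trace Φ Γ) → P ⟹⟨ u ⟩ → ∃[ n ] Run n P u
  trace⇒run []      h = zero , done
  trace⇒run (α ∷ u) (_ , (_ , _ , ds , d , es) , h) =
    τ*-run ds (act d (proj₂ (τ*-run es (proj₂ (trace⇒run u h)))))

  -- The pattern behind the return maps below: leading τ-steps are carried through `op`, then `op-α`
  -- takes the visible step with all that follows. `v` is arbitrary since `op` may turn the action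
  -- into half of a communication.
  act-trace-map : (op : Process Φ Γ → Process Ψ Δ) →
                  (∀ {Q Q′} → Q —[ τ ]→ Q′ → op Q —[ τ ]→ op Q′) →
                  (∀ {Q Q′} → Q —[ vis α ]→ Q′ → Q′ ⟹⟨ u ⟩ → op Q ⟹⟨ v ⟩) →
                  P ⟹⟨ α ∷ u ⟩ → op P ⟹⟨ v ⟩
  act-trace-map op op-τ op-α (_ , (_ , _ , ds , d , es) , h) =
    τ*-trace (gmap op op-τ ds) (op-α d (τ*-trace es h))

  -- Each step pulls back along `ρ`, which yields `u`; the last component says that any process
  -- performing `u` regains `v`, whence monotonicity. Keeping the bound `n` matters for the
  -- recursion of `par-through`, which reaches this lemma through `ν-through`.
  rename-through : (ρ : Ren Φ Γ Ψ Δ) → Run n (rename ρ P) v →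
                   ∃[ u ] Run n P u × (∀ Q → Q ⟹⟨ u ⟩ → rename ρ Q ⟹⟨ v ⟩)
  rename-through ρ done = [] , done , λ _ _ → tt
  rename-through ρ (tau d r) with unrename-step ρ _ refl d
  ... | preimage τ d₀ refl with rename-through ρ r
  ...   | u , r₀ , back = u , tau d₀ r₀ , back
  rename-through ρ (act d r) with unrename-step ρ _ refl d
  ... | preimage (inp refl) d₀ refl with rename-through _ r
  ...   | u , r₀ , back = _ , act d₀ r₀ , λ Q →
    act-trace-map (rename ρ) (rename-step τ) λ e h → act-trace (rename-step (inp refl) e) (back _ h)
  rename-through ρ (act d r) | preimage (out refl) d₀ refl with rename-through _ r
  ...   | u , r₀ , back = _ , act d₀ r₀ , λ Q →
    act-trace-map (rename ρ) (rename-step τ) λ e h → act-trace (rename-step (out refl) e) (back _ h)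

  ν-through : ∀ t {P : Process Φ (t ∷ Γ)} → Run n (ν t P) v →
              ∃[ u ] Run n P u × (∀ Q → Q ⟹⟨ u ⟩ → ν t Q ⟹⟨ v ⟩)
  ν-through t done = [] , done , λ _ _ → tt
  ν-through t (tau (res d) r) with ν-through t r
  ... | u , r₀ , back = u , tau d r₀ , back
  ν-through t (act {α = inp {s} a} (res d) r) with ν-through t r
  -- The derivative is a restriction of a swapped process: the recursive call strips the
  -- restriction, and `rename-through` undoes the swap.
  ... | _ , r₁ , back₁ with rename-through (swap (ob s) t) r₁
  ...   | u , r₂ , back₂ = _ , act d r₂ , λ Q →
    act-trace-map (ν t) res λ e h → act-trace (res e) (back₁ _ (back₂ _ h))
  ν-through t (act {α = out {s} a} (res d) r) with ν-through t r
  ... | _ , r₁ , back₁ with rename-through (swap (ob s) t) r₁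
  ...   | u , r₂ , back₂ = _ , act d r₂ , λ Q →
    act-trace-map (ν t) res λ e h → act-trace (res e) (back₁ _ (back₂ _ h))

  ν*-through : ∀ t̃ {P : Process Φ (t̃ ++ Γ)} → Run n (ν* t̃ P) v →
               ∃[ u ] Run n P u × (∀ Q → Q ⟹⟨ u ⟩ → ν* t̃ Q ⟹⟨ v ⟩)
  ν*-through []      r = _ , r , λ _ h → h
  ν*-through (t ∷ t̃) r with ν*-through t̃ r
  ... | _ , r₁ , back₁ with ν-through t r₁
  ...   | u , r₂ , back₂ = u , r₂ , λ Q h → back₁ _ (back₂ Q h)

  rename-idᵣ : (P : Process Φ Γ) → rename idᵣ P ≡ P
  rename-idᵣ = rename-id idᵣ (λ _ → refl)

  -- For `τ` the rule still renames the idle component by `wk []`, which vanishes only up to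
  -- propositional equality.
  parˡ-τ : P —[ τ ]→ P′ → P ∥ Q —[ τ ]→ P′ ∥ Q
  parˡ-τ d = step-target (cong (_ ∥_) (rename-idᵣ _)) (parˡ d)

  parʳ-τ : Q —[ τ ]→ R → P ∥ Q —[ τ ]→ P ∥ R
  parʳ-τ d = step-target (cong (_∥ _) (rename-idᵣ _)) (parʳ d)

  -- Each step is charged to the components taking part: a visible action is recorded in the trace
  -- of its performer, a communication adds complementary actions to both traces. Any two processes
  -- with these traces can then be interleaved and synchronised in the same way.
  par-through : Run n (P ∥ R) v →
                ∃[ u₁ ] ∃[ u₂ ] P ⟹⟨ u₁ ⟩ × R ⟹⟨ u₂ ⟩ ×
                  (∀ Q S → Q ⟹⟨ u₁ ⟩ → S ⟹⟨ u₂ ⟩ → Q ∥ S ⟹⟨ v ⟩)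
  par-through done = [] , [] , tt , tt , λ _ _ _ _ → tt
  par-through {R = R} (tau (parˡ d) r) rewrite rename-idᵣ R with par-through r
  ... | u₁ , u₂ , h₁ , h₂ , back = u₁ , u₂ , τ-trace d h₁ , h₂ , back
  par-through {P = P} (tau (parʳ d) r) rewrite rename-idᵣ P with par-through r
  ... | u₁ , u₂ , h₁ , h₂ , back = u₁ , u₂ , h₁ , τ-trace d h₂ , back
  -- Stripping the restrictions leaves a run of the two derivatives with the same bound as `r`; the
  -- exchanged names become ordinary names that both traces may use.
  par-through (tau (comˡ {s} d e) r) with ν*-through (ob s) r
  ... | _ , r₁ , back₁ with par-through r₁
  ...   | u₁ , u₂ , h₁ , h₂ , back₂ =
    _ , _ , act-trace d h₁ , act-trace e h₂ , λ Q S hQ hS →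
      act-trace-map (_∥ S) parˡ-τ (λ d′ hQ′ →
        act-trace-map (_ ∥_) parʳ-τ (λ e′ hS′ →
          τ-trace (comˡ d′ e′) (back₁ _ (back₂ _ _ hQ′ hS′))) hS) hQ
  par-through (tau (comʳ {s} d e) r) with ν*-through (ob s) r
  ... | _ , r₁ , back₁ with par-through r₁
  ...   | u₁ , u₂ , h₁ , h₂ , back₂ =
    _ , _ , act-trace d h₁ , act-trace e h₂ , λ Q S hQ hS →
      act-trace-map (_∥ S) parˡ-τ (λ d′ hQ′ →
        act-trace-map (_ ∥_) parʳ-τ (λ e′ hS′ →
          τ-trace (comʳ d′ e′) (back₁ _ (back₂ _ _ hQ′ hS′))) hS) hQ
  par-through (act {α = α} (parˡ d) r) with par-through r
  -- The idle component was weakened by the names of `α`; its trace is pulled back to the original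
  -- scope.
  ... | u₁ , u₂ , h₁ , h₂ , back with rename-through (wk (bnᵥ α)) (proj₂ (trace⇒run u₂ h₂))
  ...   | u₂′ , r₂ , back₂ =
    _ , u₂′ , act-trace d h₁ , run⇒trace r₂ , λ Q S hQ hS →
      act-trace-map (_∥ S) parˡ-τ (λ d′ hQ′ → act-trace (parˡ d′) (back _ _ hQ′ (back₂ S hS))) hQ
  par-through (act {α = α} (parʳ d) r) with par-through r
  ... | u₁ , u₂ , h₁ , h₂ , back with rename-through (wk (bnᵥ α)) (proj₂ (trace⇒run u₁ h₁))
  ...   | u₁′ , r₁ , back₁ =
    u₁′ , _ , run⇒trace r₁ , act-trace d h₂ , λ Q S hQ hS →
      act-trace-map (Q ∥_) parʳ-τ (λ d′ hS′ → act-trace (parʳ d′) (back _ _ (back₁ Q hQ) hS′)) hS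

  -- Precongruence of trace inclusion.

  ⊑-rename : (ρ : Ren Φ Γ Ψ Δ) → P ⊑ₚ Q → rename ρ P ⊑ₚ rename ρ Q
  ⊑-rename ρ P⊑Q v h with rename-through ρ (proj₂ (trace⇒run v h))
  ... | u , r , back = back _ (P⊑Q u (run⇒trace r))

  ⊑-ν : ∀ t {P Q : Process Φ (t ∷ Γ)} → P ⊑ₚ Q → ν t P ⊑ₚ ν t Q
  ⊑-ν t P⊑Q v h with ν-through t (proj₂ (trace⇒run v h))
  ... | u , r , back = back _ (P⊑Q u (run⇒trace r))

  ⊑-∥ : P ⊑ₚ P′ → Q ⊑ₚ R → P ∥ Q ⊑ₚ P′ ∥ R
  ⊑-∥ P⊑P′ Q⊑R v h with par-through (proj₂ (trace⇒run v h))
  ... | u₁ , u₂ , h₁ , h₂ , back = back _ _ (P⊑P′ u₁ h₁) (Q⊑R u₂ h₂)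

  -- Unfolding of constants

  infix 4 _≽_
  -- Closed only under restriction and composition: these are the positions where `expand` replaces
  -- variables.
  data _≽_ {Φ Γ} : Process Φ Γ → Process Φ Γ → Set where
    ≽-refl  : P ≽ P
    ≽-trans : P ≽ Q → Q ≽ R → P ≽ R
    ≽-ν     : ∀ t {P Q : Process Φ (t ∷ Γ)} → P ≽ Q → ν t P ≽ ν t Q
    ≽-∥     : P ≽ P′ → Q ≽ R → P ∥ Q ≽ P′ ∥ R
    unfold  : ∀ {s̃} (K : Const s̃) (as : Args Φ Γ s̃) → con K as ≽ rename (closed-params as) (def K)

  ≽-reflexive : P ≡ Q → P ≽ Q
  ≽-reflexive refl = ≽-refl

  ≽-rename : (ρ : Ren Φ Γ Ψ Δ) → P ≽ Q → rename ρ P ≽ rename ρ Q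
  ≽-rename ρ ≽-refl         = ≽-refl
  ≽-rename ρ (≽-trans p q)  = ≽-trans (≽-rename ρ p) (≽-rename ρ q)
  ≽-rename ρ (≽-ν t p)      = ≽-ν t (≽-rename (lift₁ t ρ) p)
  ≽-rename ρ (≽-∥ p q)      = ≽-∥ (≽-rename ρ p) (≽-rename ρ q)
  ≽-rename ρ (unfold K as)  =
    ≽-trans (unfold K (map-args ρ as)) (≽-reflexive (sym (rename-closed ρ as (def K))))

  ≽-ν* : ∀ t̃ {P Q : Process Φ (t̃ ++ Γ)} → P ≽ Q → ν* t̃ P ≽ ν* t̃ Q
  ≽-ν* []      p = p
  ≽-ν* (t ∷ t̃) p = ≽-ν* t̃ (≽-ν t p)

  ≽-swap-bn : ∀ {t} (μ : Action Φ Γ) {P Q : Process Φ (bn (wk-action t μ) ++ t ∷ Γ)} →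
              P ≽ Q → swap-bn μ P ≽ swap-bn μ Q
  ≽-swap-bn τ             p = p
  ≽-swap-bn (vis (inp a)) p = ≽-rename _ p
  ≽-swap-bn (vis (out a)) p = ≽-rename _ p

  -- By `cst` a constant has the transitions of its unfolding, so steps are matched one for one and
  -- no τ is added or lost.
  ≽-step : P ≽ Q → Q —[ μ ]→ R → ∃[ P′ ] P —[ μ ]→ P′ × P′ ≽ R
  ≽-step ≽-refl d = _ , d , ≽-refl
  ≽-step (≽-trans p q) d with ≽-step q d
  ... | _ , d₁ , q′ with ≽-step p d₁
  ...   | _ , d₂ , p′ = _ , d₂ , ≽-trans p′ q′
  ≽-step (≽-ν t p) (res {μ = μ} d) with ≽-step p d
  ... | _ , d₁ , p′ = _ , res d₁ , ≽-ν t (≽-swap-bn μ p′)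
  ≽-step (≽-∥ p q) (parˡ d) with ≽-step p d
  ... | _ , d₁ , p′ = _ , parˡ d₁ , ≽-∥ p′ (≽-rename _ q)
  ≽-step (≽-∥ p q) (parʳ d) with ≽-step q d
  ... | _ , d₁ , q′ = _ , parʳ d₁ , ≽-∥ (≽-rename _ p) q′
  ≽-step (≽-∥ p q) (comˡ {s} d e) with ≽-step p d | ≽-step q e
  ... | _ , d₁ , p′ | _ , e₁ , q′ = _ , comˡ d₁ e₁ , ≽-ν* (ob s) (≽-∥ p′ q′)
  ≽-step (≽-∥ p q) (comʳ {s} d e) with ≽-step p d | ≽-step q e
  ... | _ , d₁ , p′ | _ , e₁ , q′ = _ , comʳ d₁ e₁ , ≽-ν* (ob s) (≽-∥ p′ q′)
  ≽-step (unfold K as) d = _ , cst d , ≽-refl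

  -- Divergence

  Convergent : Process Φ Γ → Set
  Convergent P = ¬ Divergesₚ P

  -- A divergence may begin with visible actions, so putting any step in front of one gives another.
  convergent-step : {P : Process Φ Γ} {P′ : Process Φ (bn μ ++ Γ)} →
                    Convergent P → P —[ μ ]→ P′ → Convergent P′
  convergent-step {Φ = Φ} {Γ = Γ} {μ = μ} {P = P} conv d div = conv record
    { state = state′
    ; start = refl
    ; steps = steps′
    -- The new first step delays the silent tail by one.
    ; bound = suc bound
    ; taus  = λ { (suc n) (s≤s b≤n) → taus n b≤n }
    }
    where
    open Divergesₚ div
    state′ : ℕ → State Φ
    state′ zero    = Γ , P
    state′ (suc n) = state n
    steps′ : ∀ n → state′ n —→ state′ (suc n)
    steps′ zero    = subst ((Γ , P) —→_) (sym start) (step μ d)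
    steps′ (suc n) = steps n

  -- Reversed so that accessibility descends along τ-steps.
  _τ←_ : Process Φ Γ → Process Φ Γ → Set
  P′ τ← P = P —[ τ ]→ P′

  -- Excluded middle for the type of non-accessible τ-successors selects one, so
  -- no choice principle is needed to build the infinite run.
  convergent⇒acc : {P : Process Φ Γ} → Convergent P → Acc _τ←_ P
  convergent⇒acc {Φ} {Γ} {P} conv with em {Acc _τ←_ P}
  ... | yes a = a
  ... | no ¬a = ⊥-elim (conv record
    { state = λ n → Γ , proj₁ (run n)
    ; start = refl
    ; steps = λ n → step τ (proj₁ (proj₂ (next (run n))))
    ; bound = zero
    ; taus  = λ _ _ → tt
    })
    where
    NonAcc : Set
    NonAcc = ∃[ Q ] ¬ Acc (_τ←_ {Φ} {Γ}) Q
    next : ((Q , _) : NonAcc) → ∃[ Q′ ] Q —[ τ ]→ Q′ × ¬ Acc _τ←_ Q′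
    next (Q , ¬acc) with em {∃[ Q′ ] Q —[ τ ]→ Q′ × ¬ Acc _τ←_ Q′}
    ... | yes successor = successor
    ... | no ¬successor = ⊥-elim (¬acc (acc λ {Q′} d → accessible Q′ d))
      where
      accessible : ∀ Q′ → Q —[ τ ]→ Q′ → Acc _τ←_ Q′
      accessible Q′ d with em {Acc _τ←_ Q′}
      ... | yes a = a
      ... | no ¬a = ⊥-elim (¬successor (Q′ , d , ¬a))
    run : ℕ → NonAcc
    run zero    = P , ¬a
    run (suc n) with next (run n)
    ... | Q′ , _ , ¬acc = Q′ , ¬acc

  -- Contexts: processes with equation variables

  private variable
    V : Arity → Set
    s̃ : Arity
    s t : Sort

  -- `ρ` acts on name-closed contexts, `ρ′` on their instances, which also contain the free names of
  -- the substituted tuple. As `ρ′` fixes these, filling a context commutes with renaming.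
  record Extension (ρ : Ren ∅ Γ ∅ Δ) (ρ′ : Ren Φ Γ Φ Δ) : Set where
    constructor extension
    field
      on-free  : ∀ {s} (c : Φ s) → fun ρ′ (free c) ≡ free c
      on-bound : ∀ {s} (a : Name ∅ Γ s) → fun ρ′ (embed-name a) ≡ embed-name (fun ρ a)

  open Extension

  embed-wk₁ : (a : Name ∅ Γ s) → wk₁-name {Φ} {t = t} (embed-name a) ≡ embed-name (wk₁-name a)
  embed-wk₁ (local x) = refl

  extension-∘ : ∀ {Θ} {σ : Ren ∅ Δ ∅ Θ} {σ′ : Ren Φ Δ Φ Θ} {ρ : Ren ∅ Γ ∅ Δ} {ρ′ : Ren Φ Γ Φ Δ} →
                Extension σ σ′ → Extension ρ ρ′ → Extension (σ ∘ᵣ ρ) (σ′ ∘ᵣ ρ′)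
  on-free  (extension-∘ {σ′ = σ′} e f) c = trans (cong (fun σ′) (on-free f c)) (on-free e c)
  on-bound (extension-∘ {σ′ = σ′} e f) a = trans (cong (fun σ′) (on-bound f a)) (on-bound e _)

  extension-lift₁ : ∀ t {ρ : Ren ∅ Γ ∅ Δ} {ρ′ : Ren Φ Γ Φ Δ} →
                    Extension ρ ρ′ → Extension (lift₁ t ρ) (lift₁ t ρ′)
  on-free  (extension-lift₁ t e) c                 = cong wk₁-name (on-free e c)
  on-bound (extension-lift₁ t e) (local (here p))  = refl
  on-bound (extension-lift₁ t e) (local (there x)) =
    trans (cong wk₁-name (on-bound e (local x))) (embed-wk₁ _)

  extension-lift : ∀ t̃ {ρ : Ren ∅ Γ ∅ Δ} {ρ′ : Ren Φ Γ Φ Δ} →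
                   Extension ρ ρ′ → Extension (lift t̃ ρ) (lift t̃ ρ′)
  extension-lift []      e = e
  extension-lift (t ∷ t̃) e = extension-lift₁ t (extension-lift t̃ e)

  extension-wk : ∀ t̃ → Extension {Γ} {Φ = Φ} (wk t̃) (wk t̃)
  extension-wk []      = extension (λ _ → refl) (λ _ → refl)
  extension-wk (t ∷ t̃) = extension-∘ {σ = wk₁ t} {wk₁ t} (extension (λ _ → refl) embed-wk₁) (extension-wk t̃)

  extension-swap₁ : ∀ t s → Extension {t ∷ s ∷ Γ} {Φ = Φ} (swap₁ t s) (swap₁ t s)
  on-free  (extension-swap₁ t s) c                         = refl
  on-bound (extension-swap₁ t s) (local (here p))          = refl
  on-bound (extension-swap₁ t s) (local (there (here p)))  = refl
  on-bound (extension-swap₁ t s) (local (there (there x))) = refl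

  extension-swap : ∀ t̃ s → Extension {t̃ ++ s ∷ Γ} {Φ = Φ} (swap t̃ s) (swap t̃ s)
  extension-swap []      s = extension (λ _ → refl) (λ _ → refl)
  extension-swap (t ∷ t̃) s =
    extension-∘ (extension-swap₁ t s) (extension-lift₁ t (extension-swap t̃ s))

  extension-params : (as : Args ∅ Γ s̃) → Extension {Φ = Φ} (closed-params as) (open-params as)
  extension-params as = extension (λ _ → refl) λ { (local x) → refl }

  extension-args : {ρ : Ren ∅ Γ ∅ Δ} {ρ′ : Ren Φ Γ Φ Δ} → Extension ρ ρ′ → (as : Args ∅ Γ s̃) →
                   map-args embed (map-args ρ as) ≡ map-args ρ′ (map-args embed as)
  extension-args {ρ = ρ} {ρ′} e as =
    trans (map-args-∘ embed ρ (ρ′ ∘ᵣ embed) (λ a → sym (on-bound e a)) as)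
          (sym (map-args-∘ ρ′ embed (ρ′ ∘ᵣ embed) (λ _ → refl) as))

  apply-rename : {ρ : Ren ∅ Γ ∅ Δ} {ρ′ : Ren Φ Γ Φ Δ} → Extension ρ ρ′ →
                 (F : Abstraction Φ s̃) (as : Args ∅ Γ s̃) → F ⟨ map-args ρ as ⟩ ≡ rename ρ′ (F ⟨ as ⟩)
  apply-rename {ρ = ρ} {ρ′} e (abs P) (args as d) =
    sym (rename-∘ ρ′ (open-params (args as d)) (open-params (map-args ρ (args as d)))
      (λ { (free c)  → on-free e c
         ; (local x) → trans (on-bound e (lookup as x)) (cong embed-name (sym (lookup-map as x))) }) P)
  apply-rename e (con K) as = cong (con K) (extension-args e as)

  subst-rename : {ρ : Ren ∅ Γ ∅ Δ} {ρ′ : Ren Φ Γ Φ Δ} → Extension ρ ρ′ →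
                 (C : Proc V ∅ Γ) (F : Tuple V Φ) → rename ρ C [ F ]ₚ ≡ rename ρ′ (C [ F ]ₚ)
  subst-rename e 𝟘              F = refl
  subst-rename e (inp {s} a C)  F = cong₂ inp (sym (on-bound e a)) (subst-rename (extension-lift (ob s) e) C F)
  subst-rename e (out {s} a C)  F = cong₂ out (sym (on-bound e a)) (subst-rename (extension-lift (ob s) e) C F)
  subst-rename e (ν t C)        F = cong (ν t) (subst-rename (extension-lift₁ t e) C F)
  subst-rename e (C ∥ D)        F = cong₂ _∥_ (subst-rename e C F) (subst-rename e D F)
  subst-rename e (!inp {s} a C) F = cong₂ !inp (sym (on-bound e a)) (subst-rename (extension-lift (ob s) e) C F)
  subst-rename e (con K as)     F = cong (con K) (extension-args e as)
  subst-rename e (var X as)     F = apply-rename e (F X) as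

  -- Derivatives of contexts, and transitions of guarded contexts.

  νs : ∀ t̃ → Proc V Φ (t̃ ++ Γ) → Proc V Φ Γ
  νs []      C = C
  νs (t ∷ t̃) C = νs t̃ (ν t C)

  subst-νs : ∀ t̃ (C : Proc V ∅ (t̃ ++ Γ)) (F : Tuple V Φ) → νs t̃ C [ F ]ₚ ≡ ν* t̃ (C [ F ]ₚ)
  subst-νs []      C F = refl
  subst-νs (t ∷ t̃) C F = subst-νs t̃ (ν t C) F

  -- Makes a context of the variable-free derivative of an unfolded constant.
  inject : Process Φ Γ → Proc V Φ Γ
  inject 𝟘          = 𝟘
  inject (inp a P)  = inp a (inject P)
  inject (out a P)  = out a (inject P)
  inject (ν t P)    = ν t (inject P)
  inject (P ∥ Q)    = inject P ∥ inject Q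
  inject (!inp a P) = !inp a (inject P)
  inject (con K as) = con K as

  lift₁-embed : (ρ : Ren ∅ Γ Φ Γ) → ρ ≗ embed → lift₁ t ρ ≗ embed
  lift₁-embed ρ eq (local (here p))  = refl
  lift₁-embed ρ eq (local (there x)) = cong wk₁-name (eq (local x))

  lift-embed : ∀ t̃ (ρ : Ren ∅ Γ Φ Γ) → ρ ≗ embed → lift t̃ ρ ≗ embed
  lift-embed []      ρ eq = eq
  lift-embed (t ∷ t̃) ρ eq = lift₁-embed (lift t̃ ρ) (lift-embed t̃ ρ eq)

  subst-inject : (ρ : Ren ∅ Γ Φ Γ) → ρ ≗ embed → (P : Process ∅ Γ) (F : Tuple V Φ) →
                 inject P [ F ]ₚ ≡ rename ρ P
  subst-inject ρ eq 𝟘              F = refl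
  subst-inject ρ eq (inp {s} a P)  F = cong₂ inp (sym (eq a)) (subst-inject _ (lift-embed (ob s) ρ eq) P F)
  subst-inject ρ eq (out {s} a P)  F = cong₂ out (sym (eq a)) (subst-inject _ (lift-embed (ob s) ρ eq) P F)
  subst-inject ρ eq (ν t P)        F = cong (ν t) (subst-inject _ (lift₁-embed ρ eq) P F)
  subst-inject ρ eq (P ∥ Q)        F = cong₂ _∥_ (subst-inject ρ eq P F) (subst-inject ρ eq Q F)
  subst-inject ρ eq (!inp {s} a P) F = cong₂ !inp (sym (eq a)) (subst-inject _ (lift-embed (ob s) ρ eq) P F)
  subst-inject ρ eq (con K (args as _)) F = cong (con K) (args-≡ (map-cong as (λ a → sym (eq a))))

  -- Always plain substitution; the cases serve only to identify `bn μ₀` with `bn μ`.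
  fill : {μ₀ : Action ∅ Γ} {μ : Action Φ Γ} → embed ⊢ μ₀ ↦ μ →
         Proc V ∅ (bn μ₀ ++ Γ) → Tuple V Φ → Process Φ (bn μ ++ Γ)
  fill τ       C F = C [ F ]ₚ
  fill (inp _) C F = C [ F ]ₚ
  fill (out _) C F = C [ F ]ₚ

  fill-∥ : {μ₀ : Action ∅ Γ} {μ : Action Φ Γ} (m : embed ⊢ μ₀ ↦ μ) (C D : Proc V ∅ (bn μ₀ ++ Γ))
           (F : Tuple V Φ) → fill m (C ∥ D) F ≡ fill m C F ∥ fill m D F
  fill-∥ τ       C D F = refl
  fill-∥ (inp _) C D F = refl
  fill-∥ (out _) C D F = refl

  fill-wk : {μ₀ : Action ∅ Γ} {μ : Action Φ Γ} (m : embed ⊢ μ₀ ↦ μ) (C : Proc V ∅ Γ)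
            (F : Tuple V Φ) → fill m (rename (wk (bn μ₀)) C) F ≡ rename (wk (bn μ)) (C [ F ]ₚ)
  fill-wk τ           C F = subst-rename (extension-wk []) C F
  fill-wk (inp {s} _) C F = subst-rename (extension-wk (ob s)) C F
  fill-wk (out {s} _) C F = subst-rename (extension-wk (ob s)) C F

  fill-inject : {μ₀ : Action ∅ Γ} {μ : Action Φ Γ} (m : embed ⊢ μ₀ ↦ μ) (P : Process ∅ (bn μ₀ ++ Γ))
                (F : Tuple V Φ) → fill m (inject P) F ≡ rename (lift-bn m) P
  fill-inject τ           P F = subst-inject embed (λ _ → refl) P F
  fill-inject (inp {s} _) P F = subst-inject _ (lift-embed (ob s) embed (λ _ → refl)) P F
  fill-inject (out {s} _) P F = subst-inject _ (lift-embed (ob s) embed (λ _ → refl)) P F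

  -- The context moves by itself: `uniform` lets every instance make the step, with the same
  -- derivative context. It ranges over all `Ψ` because the syntactic solution has no free names
  -- while the compared tuples may have some.
  record ContextStep (C : Proc V ∅ Γ) (F : Tuple V Φ)
                     (μ : Action Φ Γ) (R : Process Φ (bn μ ++ Γ)) : Set₁ where
    constructor context-step
    field
      {action} : Action ∅ Γ
      context  : Proc V ∅ (bn action ++ Γ)
      image    : embed ⊢ action ↦ μ
      target≡  : R ≡ fill image context F
      uniform  : ∀ {Ψ} (H : Tuple V Ψ) {μ′ : Action Ψ Γ} (m : embed ⊢ action ↦ μ′) →
                 C [ H ]ₚ —[ μ′ ]→ fill m context H

  unembed-wk₁ : (a : Name ∅ (t ∷ Γ) s) {b : Name Φ Γ s} →
                embed-name a ≡ wk₁-name b → ∃[ a₀ ] a ≡ wk₁-name a₀ × embed-name a₀ ≡ b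
  unembed-wk₁ (local (here p))  {free _}  ()
  unembed-wk₁ (local (here p))  {local _} ()
  unembed-wk₁ (local (there x)) eq = local x , refl , wk₁-injective eq

  embed-wk₁-≡ : (a : Name ∅ Γ s) {b : Name Φ Γ s} → embed-name a ≡ b →
                embed-name (wk₁-name {t = t} a) ≡ wk₁-name b
  embed-wk₁-≡ a refl = sym (embed-wk₁ a)

  res-context-step : {C : Proc V ∅ (t ∷ Γ)} {F : Tuple V Φ} {μ : Action Φ Γ} → ∀ {R} →
                     ContextStep C F (wk-action t μ) R → ContextStep (ν t C) F μ (ν t (swap-bn μ R))
  res-context-step {μ = τ} (context-step C′ τ refl uniform) =
    context-step (ν _ C′) τ refl λ { H τ → res (uniform H τ) }
  res-context-step {t = t} {F = F} {μ = vis (inp {s} b)} (context-step C′ (inp {a = a} eq) refl uniform)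
    with unembed-wk₁ a eq
  ... | a₀ , refl , eq₀ =
    context-step (ν t (rename (swap (ob s) t) C′)) (inp eq₀)
      (cong (ν t) (sym (subst-rename (extension-swap (ob s) t) C′ F)))
      λ { H (inp eq′) → step-target (cong (ν t) (sym (subst-rename (extension-swap (ob s) t) C′ H)))
                                 (res (uniform H (inp (embed-wk₁-≡ a₀ eq′)))) }
  res-context-step {t = t} {F = F} {μ = vis (out {s} b)} (context-step C′ (out {a = a} eq) refl uniform)
    with unembed-wk₁ a eq
  ... | a₀ , refl , eq₀ =
    context-step (ν t (rename (swap (ob s) t) C′)) (out eq₀)
      (cong (ν t) (sym (subst-rename (extension-swap (ob s) t) C′ F)))
      λ { H (out eq′) → step-target (cong (ν t) (sym (subst-rename (extension-swap (ob s) t) C′ H)))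
                                 (res (uniform H (out (embed-wk₁-≡ a₀ eq′)))) }

  -- In a guarded context every step starts at prefixes or constants of the context, so the
  -- substituted tuple is carried along unexamined.
  guarded-step : (C : Proc V ∅ Γ) (F : Tuple V Φ) → Guardedₚ C → {μ : Action Φ Γ} → ∀ {R} →
                 C [ F ]ₚ —[ μ ]→ R → ContextStep C F μ R
  guarded-step (inp a C) F g inp = context-step C (inp refl) refl λ { H (inp refl) → inp }
  guarded-step (out a C) F g out = context-step C (out refl) refl λ { H (out refl) → out }
  guarded-step (!inp {s} a C) F g rep =
    context-step (C ∥ rename (wk (ob s)) (!inp a C)) (inp refl)
      (cong ((C [ F ]ₚ) ∥_) (sym (subst-rename (extension-wk (ob s)) (!inp a C) F)))
      λ { H (inp refl) → step-target (cong ((C [ H ]ₚ) ∥_) (sym (subst-rename (extension-wk (ob s)) (!inp a C) H))) rep }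
  guarded-step (ν t C) F g (res d) = res-context-step (guarded-step C F g d)
  guarded-step (C ∥ D) F (g , _) (parˡ d) with guarded-step C F g d
  ... | context-step C′ m refl uniform =
    context-step (C′ ∥ rename (wk _) D) m (eq F m) λ H m′ → step-target (eq H m′) (parˡ (uniform H m′))
    where
    eq : ∀ {Ψ} (H : Tuple _ Ψ) {μ′ : Action Ψ _} (m′ : embed ⊢ _ ↦ μ′) →
         fill m′ C′ H ∥ rename (wk (bn μ′)) (D [ H ]ₚ) ≡ fill m′ (C′ ∥ rename (wk _) D) H
    eq H m′ = sym (trans (fill-∥ m′ C′ _ H) (cong (fill m′ C′ H ∥_) (fill-wk m′ D H)))
  guarded-step (C ∥ D) F (_ , g) (parʳ d) with guarded-step D F g d
  ... | context-step D′ m refl uniform =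
    context-step (rename (wk _) C ∥ D′) m (eq F m) λ H m′ → step-target (eq H m′) (parʳ (uniform H m′))
    where
    eq : ∀ {Ψ} (H : Tuple _ Ψ) {μ′ : Action Ψ _} (m′ : embed ⊢ _ ↦ μ′) →
         rename (wk (bn μ′)) (C [ H ]ₚ) ∥ fill m′ D′ H ≡ fill m′ (rename (wk _) C ∥ D′) H
    eq H m′ = sym (trans (fill-∥ m′ _ D′ H) (cong (_∥ fill m′ D′ H) (fill-wk m′ C H)))
  guarded-step (C ∥ D) F (g , g′) (comˡ {s} d e) with guarded-step C F g d | guarded-step D F g′ e
  ... | context-step C′ (inp eq) refl uniform | context-step D′ (out eq′) refl uniform′
    with refl ← embed-injective (trans eq (sym eq′)) =
    context-step (νs (ob s) (C′ ∥ D′)) τ (sym (subst-νs (ob s) (C′ ∥ D′) F))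
      λ { H τ → step-target (sym (subst-νs (ob s) (C′ ∥ D′) H)) (comˡ (uniform H (inp refl)) (uniform′ H (out refl))) }
  guarded-step (C ∥ D) F (g , g′) (comʳ {s} d e) with guarded-step C F g d | guarded-step D F g′ e
  ... | context-step C′ (out eq) refl uniform | context-step D′ (inp eq′) refl uniform′
    with refl ← embed-injective (trans eq (sym eq′)) =
    context-step (νs (ob s) (C′ ∥ D′)) τ (sym (subst-νs (ob s) (C′ ∥ D′) F))
      λ { H τ → step-target (sym (subst-νs (ob s) (C′ ∥ D′) H)) (comʳ (uniform H (out refl)) (uniform′ H (inp refl))) }
  -- The unfolding is the embedding of a process without free names, so the step is pulled back to
  -- that process and then pushed forward for every instance.
  guarded-step (con K as) F g (cst d)
    with unrename-step embed _ (sym (rename-closed embed as (def K))) d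
  ... | preimage m d₀ refl =
    context-step (inject _) m (sym (fill-inject m _ F)) λ H m′ →
      cst (step-target (sym (fill-inject m′ _ H))
        (step-source (sym (rename-closed embed as (def K))) (rename-step m′ d₀)))

  guarded-rename : (ρ : Ren Φ Γ Ψ Δ) (C : Proc V Φ Γ) → Guardedₚ C → Guardedₚ (rename ρ C)
  guarded-rename ρ 𝟘          g        = tt
  guarded-rename ρ (inp a C)  g        = tt
  guarded-rename ρ (out a C)  g        = tt
  guarded-rename ρ (ν t C)    g        = guarded-rename (lift₁ t ρ) C g
  guarded-rename ρ (C ∥ D)    (g , g′) = guarded-rename ρ C g , guarded-rename ρ D g′
  guarded-rename ρ (!inp a C) g        = tt
  guarded-rename ρ (con K as) g        = tt

  -- Fresh parameters and bodies of abstractions.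

  all-ext : {as bs : All (Name Φ Γ) s̃} → (∀ {s} (x : s ∈ s̃) → lookup as x ≡ lookup bs x) → as ≡ bs
  all-ext {as = []}     {[]}     eq = refl
  all-ext {as = a ∷ as} {b ∷ bs} eq = cong₂ _∷_ (eq (here refl)) (all-ext (λ x → eq (there x)))

  lookup-map-fresh : (ρ : Ren Φ s̃ Ψ Δ) (x : s ∈ s̃) →
                     lookup (Args.names (map-args ρ fresh)) x ≡ fun ρ (local x)
  lookup-map-fresh ρ x =
    trans (lookup-map (tabulate local) x) (cong (fun ρ) (lookup-tabulate-local (λ z → z) x))

  embed-fresh : map-args (embed {Φ} {s̃}) fresh ≡ fresh
  embed-fresh = args-≡ (all-ext λ x →
    trans (lookup-map-fresh embed x) (sym (lookup-tabulate-local (λ z → z) x)))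

  open-params-fresh : (as : Args ∅ Γ s̃) → map-args (open-params {Φ} as) fresh ≡ map-args embed as
  open-params-fresh (args as d) = args-≡ (all-ext λ x →
    trans (lookup-map-fresh (open-params (args as d)) x) (sym (lookup-map as x)))

  closed-params-fresh : closed-params (fresh {∅} {s̃}) ≗ idᵣ
  closed-params-fresh (local x) = lookup-tabulate-local (λ z → z) x

  apply-body : (F : Abstraction Φ s̃) (as : Args ∅ Γ s̃) → F ⟨ as ⟩ ≡ rename (open-params as) (body F)
  apply-body (abs P) as = refl
  apply-body (con K) as = cong (con K) (sym (open-params-fresh as))

  body-subst : (E : Expression V s̃) (F : Tuple V Φ) → body (E [ F ]) ≡ body E [ F ]ₚ
  body-subst (abs C) F = refl
  body-subst (con K) F = cong (con K) (sym embed-fresh)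

  -- Expansion of unguarded variables.

  module Expansion (𝓔 : System) where

    expand : Proc (Var 𝓔) ∅ Γ → Proc (Var 𝓔) ∅ Γ
    expand (ν t C)    = ν t (expand C)
    expand (C ∥ D)    = expand C ∥ expand D
    expand (var X as) = rename (closed-params as) (body (rhs 𝓔 X))
    expand C          = C

    -- One round suffices, since the inserted right-hand sides are themselves guarded.
    expand-guarded : Guarded 𝓔 → (C : Proc (Var 𝓔) ∅ Γ) → Guardedₚ (expand C)
    expand-guarded g 𝟘          = tt
    expand-guarded g (inp a C)  = tt
    expand-guarded g (out a C)  = tt
    expand-guarded g (ν t C)    = expand-guarded g C
    expand-guarded g (C ∥ D)    = expand-guarded g C , expand-guarded g D
    expand-guarded g (!inp a C) = tt
    expand-guarded g (con K as) = tt
    expand-guarded g (var X as) = guarded-rename (closed-params as) (body (rhs 𝓔 X)) (g X)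

    expand-var : (X : Var 𝓔 s̃) (as : Args ∅ Γ s̃) (F : Tuple (Var 𝓔) Φ) →
                 expand (var X as) [ F ]ₚ ≡ rename (open-params as) (body (rhs 𝓔 X [ F ]))
    expand-var X as F =
      trans (subst-rename (extension-params as) (body (rhs 𝓔 X)) F)
            (cong (rename (open-params as)) (sym (body-subst (rhs 𝓔 X) F)))

    -- Variables are replaced only under restriction and composition, which preserve trace
    -- inclusion; at a variable the post-fixed point inequality is instantiated by an injective
    -- renaming.
    post-expand : (F : Tuple (Var 𝓔) Φ) → PostFixedPoint 𝓔 F →
                  (C : Proc (Var 𝓔) ∅ Γ) → C [ F ]ₚ ⊑ₚ expand C [ F ]ₚ
    post-expand F post 𝟘          _ h = h
    post-expand F post (inp a C)  _ h = h
    post-expand F post (out a C)  _ h = h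
    post-expand F post (ν t C)        = ⊑-ν t (post-expand F post C)
    post-expand F post (C ∥ D)        = ⊑-∥ (post-expand F post C) (post-expand F post D)
    post-expand F post (!inp a C) _ h = h
    post-expand F post (con K as) _ h = h
    post-expand F post (var X as)
      rewrite apply-body (F X) as | expand-var X as F = ⊑-rename (open-params as) (post X)

    expand-pre : (G : Tuple (Var 𝓔) Φ) → PreFixedPoint 𝓔 G →
                 (C : Proc (Var 𝓔) ∅ Γ) → expand C [ G ]ₚ ⊑ₚ C [ G ]ₚ
    expand-pre G pre 𝟘          _ h = h
    expand-pre G pre (inp a C)  _ h = h
    expand-pre G pre (out a C)  _ h = h
    expand-pre G pre (ν t C)        = ⊑-ν t (expand-pre G pre C)
    expand-pre G pre (C ∥ D)        = ⊑-∥ (expand-pre G pre C) (expand-pre G pre D)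
    expand-pre G pre (!inp a C) _ h = h
    expand-pre G pre (con K as) _ h = h
    expand-pre G pre (var X as)
      rewrite apply-body (G X) as | expand-var X as G = ⊑-rename (open-params as) (pre X)

    -- Comparison of contexts, controlled by the syntactic solution.

    module _ (K : ∀ {s̃} → Var 𝓔 s̃ → Const s̃) (solution : IsSyntacticSolution 𝓔 K) where

      Kᵉ : Tuple (Var 𝓔) ∅
      Kᵉ X = con (K X)

      -- `K X` is defined as its right-hand side filled with the solution, so expanding a variable
      -- amounts to unfolding a constant.
      ≽-expand : (C : Proc (Var 𝓔) ∅ Γ) → C [ Kᵉ ]ₚ ≽ expand C [ Kᵉ ]ₚ
      ≽-expand 𝟘          = ≽-refl
      ≽-expand (inp a C)  = ≽-refl
      ≽-expand (out a C)  = ≽-refl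
      ≽-expand (ν t C)    = ≽-ν t (≽-expand C)
      ≽-expand (C ∥ D)    = ≽-∥ (≽-expand C) (≽-expand D)
      ≽-expand (!inp a C) = ≽-refl
      ≽-expand (con K as) = ≽-refl
      ≽-expand (var X as@(args names _)) = ≽-trans (unfold (K X) (map-args embed as)) (≽-reflexive
        -- Over `∅` the two forms of parameter substitution agree, as bodies contain no free name.
        (trans (rename-cong _ (open-params as) (λ { (free ()) ; (local x) → lookup-map names x }) (def (K X)))
        (trans (cong (rename (open-params as)) (solution X)) (sym (expand-var X as Kᵉ)))))

      module _ (guarded : Guarded 𝓔) (F G : Tuple (Var 𝓔) Φ)
               (post : PostFixedPoint 𝓔 F) (pre : PreFixedPoint 𝓔 G) where

        -- One round of the induction, with its hypotheses as arguments: after a τ-step the trace is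
        -- unchanged but `P` has made a τ-step too; after a visible step the trace is shorter.
        expand-step : (C : Proc (Var 𝓔) ∅ Γ) {P : Process ∅ Γ} → P ≽ C [ Kᵉ ]ₚ → Convergent P →
          (∀ C′ {P′} → P —[ τ ]→ P′ → P′ ≽ C′ [ Kᵉ ]ₚ → Convergent P′ →
             C′ [ F ]ₚ ⟹⟨ α ∷ u ⟩ → C′ [ G ]ₚ ⟹⟨ α ∷ u ⟩) →
          (∀ C′ {P′} → P′ ≽ C′ [ Kᵉ ]ₚ → Convergent P′ → C′ [ F ]ₚ ⟹⟨ u ⟩ → C′ [ G ]ₚ ⟹⟨ u ⟩) →
          ∀ {n} → Run n (expand C [ F ]ₚ) (α ∷ u) → expand C [ G ]ₚ ⟹⟨ α ∷ u ⟩
        expand-step C p conv after-τ after-α (tau d r)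
          with guarded-step (expand C) F (expand-guarded guarded C) d
        -- `uniform` serves twice: at `Kᵉ` to follow the step in `P`, and at `G` to answer it.
        ... | context-step C′ τ refl uniform with ≽-step (≽-trans p (≽-expand C)) (uniform Kᵉ τ)
        ...   | _ , d′ , p′ =
          τ-trace (uniform G τ) (after-τ C′ d′ p′ (convergent-step conv d′) (run⇒trace r))
        expand-step C p conv after-τ after-α (act d r)
          with guarded-step (expand C) F (expand-guarded guarded C) d
        ... | context-step C′ (inp refl) refl uniform
          with ≽-step (≽-trans p (≽-expand C)) (uniform Kᵉ (inp refl))
        ...   | _ , d′ , p′ =
          act-trace (uniform G (inp refl)) (after-α C′ p′ (convergent-step conv d′) (run⇒trace r))
        expand-step C p conv after-τ after-α (act d r)
            | context-step C′ (out refl) refl uniform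
          with ≽-step (≽-trans p (≽-expand C)) (uniform Kᵉ (out refl))
        ...   | _ , d′ , p′ =
          act-trace (uniform G (out refl)) (after-α C′ p′ (convergent-step conv d′) (run⇒trace r))

        -- P is reachable from the syntactic solution. Being convergent, it bounds
        -- how often C is expanded before the next visible action of the trace.
        context-⊑ : (u : Trace Φ Γ) (C : Proc (Var 𝓔) ∅ Γ) {P : Process ∅ Γ} →
                    P ≽ C [ Kᵉ ]ₚ → Convergent P → Acc _τ←_ P → C [ F ]ₚ ⟹⟨ u ⟩ → C [ G ]ₚ ⟹⟨ u ⟩
        context-⊑ []      C p conv _        h = tt
        context-⊑ (α ∷ u) C p conv (acc ac) h =
          expand-pre G pre C (α ∷ u)
            (expand-step C p conv
              (λ C′ d p′ conv′ → context-⊑ (α ∷ u) C′ p′ conv′ (ac d))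
              (λ C′ p′ conv′ → context-⊑ u C′ p′ conv′ (convergent⇒acc conv′))
              (proj₂ (trace⇒run (α ∷ u) (post-expand F post C (α ∷ u) h))))

        -- The fixed-point inequalities reduce the claim to the two instances of the body of the
        -- equation for `X`, a context whose instance by the solution is the unfolding of `K X`.
        post-⊑-pre : (∀ {s̃} (X : Var 𝓔 s̃) → ¬ Diverges {∅} (con (K X))) →
                     (X : Var 𝓔 s̃) → F X ⊑tr G X
        post-⊑-pre conv X u h = pre X u
          (subst (_⟹⟨ u ⟩) (sym (body-subst (rhs 𝓔 X) G))
            (context-⊑ u (body (rhs 𝓔 X)) unfolded (conv X) (convergent⇒acc (conv X))
              (subst (_⟹⟨ u ⟩) (body-subst (rhs 𝓔 X) F) (post X u h))))
          where
          unfolded : con (K X) fresh ≽ body (rhs 𝓔 X) [ Kᵉ ]ₚ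
          unfolded = ≽-trans (unfold (K X) fresh) (≽-reflexive
            (trans (rename-id (closed-params fresh) closed-params-fresh (def (K X)))
            (trans (solution X) (body-subst (rhs 𝓔 X) Kᵉ))))

-- Transfer along the extension.

theorem6p7 : ExcludedMiddle 0ℓ →
    (Sort : Set) (ob : Sort → List Sort) (Const : List Sort → Set) →
    let open Syntax Sort ob Const in
    (def : ∀ {s̃} → Const s̃ → Process ∅ s̃) →
    let open Semantics def in
    (Φ : Free) (𝓔 𝓔′ : System) →
    Extends Φ 𝓔′ 𝓔 →
    Guarded 𝓔′ →
    (K : ∀ {s̃} → Var 𝓔′ s̃ → Const s̃) →
    IsSyntacticSolution 𝓔′ K →
    (∀ {s̃} (X : Var 𝓔′ s̃) → ¬ Diverges {∅} (con (K X))) →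
    (F G : Tuple (Var 𝓔) Φ) →
    PostFixedPoint 𝓔 F →
    PreFixedPoint 𝓔 G →
    ∀ {s̃} (X : Var 𝓔 s̃) → F X ⊑tr G X
theorem6p7 em Sort ob Const def Φ 𝓔 𝓔′ ext guarded K solution conv F G F-post G-pre X
  -- Both tuples are completed to tuples for `𝓔′`, whose components at `ι X` are the original ones
  -- at `X`.
  with Syntax.Semantics.Extends.post ext F F-post | Syntax.Semantics.Extends.pre ext G G-pre
... | F′ , F′-post , F≡ | G′ , G′-pre , G≡
  rewrite F≡ X | G≡ X =
  post-⊑-pre K solution guarded F′ G′ F′-post G′-pre conv (Syntax.Semantics.Extends.ι ext X)
  where
  open Steps em Sort ob Const def
  open Expansion 𝓔′
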